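{- Let $q=2^m$ where $m\ge 4$ is even. Let $\mathcal{P}=\mathrm{GF}(q)$, $B=\{u\in\mathrm{GF}(q):\mathrm{Tr}(u^3)=1\}$ and $\mathcal{B}=\{g(B):g\in\mathrm{GA}_1(q)\}$, where $\mathrm{GA}_1(q)=\{x\mapsto ax+b:a\in\mathrm{GF}(q)^*,b\in\mathrm{GF}(q)\}$. Then $(\mathcal{P},\mathcal{B})$ is a $2$-$(2^m,k,k(k-1)/12)$ design, where $k=2^{m-1}+(-2)^{m/2}$.
   Context: $\mathrm{Tr}$ denotes the absolute trace from $\mathrm{GF}(2^m)$ to $\mathrm{GF}(2)$. A $t$-$(v,k,\lambda)$ design is a pair $(\mathcal{P},\mathcal{B})$ with $|\mathcal{P}|=v$ and $\mathcal{B}$ a set of $k$-subsets of $\mathcal{P}$ such that every $t$-subset of $\mathcal{P}$ lies in exactly $\lambda$ members of $\mathcal{B}$. -}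

module Defs where

open import Level using (Level; _⊔_) renaming (suc to lsuc)
open import Data.Nat as ℕ using (ℕ; zero; suc; _∸_)
open import Data.Bool using (Bool; true; false; _∧_)
open import Data.Fin using (Fin)
open import Data.Fin.Subset using (Subset; _∈_; ∣_∣)
open import Data.Vec using (tabulate; lookup)
open import Data.List using (List; []; _∷_; concatMap; map; filter; deduplicate; length)
open import Data.List using () renaming (allFin to allFinL)
open import Data.List.Relation.Unary.Any using (any?)
open import Data.Product using (Σ; _×_; _,_)
open import Relation.Nullary using (¬_; Dec; yes; no; does)
open import Relation.Binary using (Decidable)
open import Relation.Binary.PropositionalEquality using (_≡_)
open import Algebra.Bundles using (CommutativeRing)
open import Data.Vec.Properties using ()
import Data.Vec as V

record FiniteField (q : ℕ) (c ℓ : Level) : Set (lsuc (c ⊔ ℓ)) where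
  field
    commRing : CommutativeRing c ℓ
  open CommutativeRing commRing public
  field
    1≉0     : ¬ (1# ≈ 0#)
    inverse : ∀ x → ¬ (x ≈ 0#) → Σ Carrier (λ y → (x * y) ≈ 1#)
    _≟_     : Decidable _≈_
    enum    : Fin q → Carrier
    enum-injective  : ∀ i j → enum i ≈ enum j → i ≡ j
    enum-surjective : ∀ x → Σ (Fin q) (λ i → enum i ≈ x)

module _ {q : ℕ} {c ℓ : Level} (F : FiniteField q c ℓ) where
  open FiniteField F

  pow : Carrier → ℕ → Carrier
  pow x zero    = 1#
  pow x (suc n) = x * pow x n

  Tr : ℕ → Carrier → Carrier
  Tr zero    x = 0#
  Tr (suc i) x = Tr i x + pow x (2 ℕ.^ i)

  -- points are indexed by Fin q via enum
  points : List (Fin q)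
  points = allFinL q

  baseBlock : ℕ → Subset q
  baseBlock m = tabulate (λ i → does (Tr m (pow (enum i) 3) ≟ 1#))

  image : Carrier → Carrier → Subset q → Subset q
  image a b S = tabulate (λ j →
    does (any? (λ i → (i ∈? S) ×-dec ((a * enum i + b) ≟ enum j)) points))
    where
      open import Data.Fin.Subset.Properties using (_∈?_)
      open import Relation.Nullary.Decidable using (_×-dec_)

  GA1 : List (Carrier × Carrier)
  GA1 = concatMap (λ i → concatMap (λ j →
          if-nonzero (enum i) ((enum i , enum j) ∷ [])) points) points
    where
      if-nonzero : Carrier → List (Carrier × Carrier) → List (Carrier × Carrier)
      if-nonzero a xs with a ≟ 0#
      ... | yes _ = []
      ... | no  _ = xs

  blocks : ℕ → List (Subset q)
  blocks m = deduplicate (≡-dec _≟B_) (map (λ { (a , b) → image a b (baseBlock m) }) GA1)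
    where open import Data.Bool.Properties using () renaming (_≟_ to _≟B_)
          open import Data.Vec.Properties using (≡-dec)

  λ-count : ℕ → Fin q → Fin q → ℕ
  λ-count m x y = length (filter (λ S → (x ∈? S) ×-dec (y ∈? S)) (blocks m))
    where
      open import Data.Fin.Subset.Properties using (_∈?_)
      open import Relation.Nullary.Decidable using (_×-dec_)

module Submission where

-- Write f(x) = Tr(x³), χ(x) = (−1)^Tr(x) and S = Σ χ(x³). Polarising f gives
-- S² = q · #{x : x⁴ = x} = 4q, and since cubing is 3-to-1 on nonzero elements S ≡ 1 (mod 3);
-- hence S = (−2)^(h+1), which determines |B|. If x ↦ cx + d preserves f, the quadratic part of
-- f(cx + d) − f(x) forces c³ = 1 and the linear part forces d⁴ = d, so B has a stabiliser of
-- order 3 · 4 = 12 in GA₁(q). As GA₁(q) is sharply 2-transitive, each pair of distinct points lies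
-- in g(B) for exactly k(k − 1) maps g, and every block arises from 12 of them.

open import Defs
open import Level using (Level; _⊔_)
open import Algebra.Bundles using (CommutativeMonoid; CommutativeRing; RawRing)
import Algebra.Properties.CommutativeMonoid.Sum as CMSum
import Algebra.Properties.Ring as RingProperties
import Algebra.Properties.Semiring.Exp as Exp
import Algebra.Properties.Semiring.Mult as Mult
import Algebra.Solver.Ring as RingSolver
open import Algebra.Solver.Ring.AlmostCommutativeRing using (fromCommutativeRing; _-Raw-AlmostCommutative⟶_)
open import Data.Bool using (Bool; true; false; if_then_else_)
import Data.Bool.Properties as Bool
open import Data.Fin using (Fin; zero; suc; punchIn; inject≤)
open import Data.Fin.Permutation using (permutation)
import Data.Fin.Properties as Fin
open import Data.Fin.Subset using (Subset; ∣_∣; _∈_)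
open import Data.Fin.Subset.Properties using (_∈?_; ⊆-antisym)
open import Data.Integer using (ℤ; +_; -[1+_]; _-_; 0ℤ; 1ℤ; -1ℤ) renaming (_+_ to _+ℤ_; _*_ to _*ℤ_; _^_ to _^ℤ_; -_ to -ℤ_; ∣_∣ to ∣_∣ℤ)
import Data.Integer.Properties as ℤ
open import Data.Integer.Tactic.RingSolver using (solve-∀)
open import Data.List using (List; []; _∷_; _++_; length; filter; deduplicate; map; concatMap; tabulate)
import Data.List.Membership.Propositional as List
open import Data.List.Membership.Propositional.Properties using (∈-allFin; ∈-deduplicate⁺; ∈-deduplicate⁻)
open import Data.List.Relation.Unary.All using (All; []; _∷_)
import Data.List.Relation.Unary.All as All
import Data.List.Relation.Unary.All.Properties as All
open import Data.List.Relation.Unary.AllPairs using ([]; _∷_)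
open import Data.List.Relation.Unary.Any using (any?; here; there; satisfied)
open import Data.List.Relation.Unary.Unique.DecPropositional.Properties using (deduplicate-!)
open import Data.List.Relation.Unary.Unique.Propositional using (Unique)
open import Data.Maybe using (Maybe; just; nothing)
open import Data.Nat using (ℕ; zero; suc; _^_; _∸_; _≤_)
import Data.Nat as ℕ
import Data.Nat.Properties as ℕ
import Data.Nat.Tactic.RingSolver as ℕSolver
open import Data.Product using (Σ; ∃; _×_; _,_; proj₁; proj₂)
open import Data.Sum using (_⊎_; inj₁; inj₂; [_,_]′)
open import Data.Vec using ([]; _∷_)
open import Data.Vec.Properties using (≡-dec; lookup∘tabulate; []=⇒lookup; lookup⇒[]=)
open import Function using (_∘_; id)
open import Relation.Binary using (DecidableEquality)
open import Relation.Binary.PropositionalEquality as ≡ using (_≡_; _≢_)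
import Relation.Binary.Reasoning.Setoid as SetoidReasoning
open import Relation.Nullary using (¬_; Dec; yes; no; does; contradiction; ¬?)
open import Relation.Nullary.Decidable using (_×-dec_; dec-true; dec-false)
open import Relation.Unary using (Pred; Decidable)

open import Algebra.Properties.Semiring.Sum ℤ.+-*-semiring
  using (sum-cong-≗; ∑-distrib-+; ∑-comm; *-distribˡ-sum; *-distribʳ-sum; sum-replicate-zero)
  renaming (sum to sumℤ)

-- The field is known only through its axioms and its size, so familiar facts are derived by
-- counting: `q×1≈0` gives characteristic 2, `pow-q` gives x^q = x, and because a monic polynomial
-- of degree below q has a nonroot, the trace takes the value 1 and a primitive cube root of unity
-- exists. The orders 3 and 4 in the stabiliser both come from the subfield GF(4), present because m
-- is even: its elements are the solutions of x⁴ = x, and the nonzero ones are the cube roots of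
-- unity. Evenness also gives Tr(1) = 0, so Tr(x³) vanishes on GF(4) and nothing cancels in S². The
-- bound h ≥ 2 excludes q = 4, where x⁴ = x holds everywhere and the cubic coefficient can no longer
-- be isolated. Counts are sums of 0/1 indicators in ℤ, since they are combined with signed
-- character values and with k - 1.

private variable
  p : Level
  P Q : Set p

-- Indicators and finite sums

module _ {a b} (M : CommutativeMonoid a b) where
  private module M = CommutativeMonoid M
  open CMSum M using (sum; sum-remove; sum-cong-≋) renaming (sum-replicate-zero to sum-0)

  sum-single : ∀ {n} (j : Fin n) (t : Fin n → M.Carrier) →
               (∀ i → i ≢ j → t i M.≈ M.ε) → sum t M.≈ t j
  sum-single {suc n} j t off = M.trans (sum-remove {i = j} t)
    (M.trans (M.∙-congˡ (M.trans (sum-cong-≋ (λ i → off (punchIn j i) (Fin.punchInᵢ≢i j i))) (sum-0 n)))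
      (M.identityʳ _))

-- The Iverson bracket. It looks only at `does`, so the proofs carried by decisions never matter.
[_] : Dec P → ℤ
[ d ] = if does d then 1ℤ else 0ℤ

[]-yes : (d : Dec P) → P → [ d ] ≡ 1ℤ
[]-yes d x rewrite dec-true d x = ≡.refl

[]-no : (d : Dec P) → ¬ P → [ d ] ≡ 0ℤ
[]-no d x rewrite dec-false d x = ≡.refl

[]-cong : (d : Dec P) (e : Dec Q) → (P → Q) → (Q → P) → [ d ] ≡ [ e ]
[]-cong (yes x) e f g = ≡.sym ([]-yes e (f x))
[]-cong (no x) e f g = ≡.sym ([]-no e (x ∘ g))

[]-× : (d : Dec P) (e : Dec Q) → [ d ×-dec e ] ≡ [ d ] *ℤ [ e ]
[]-× (yes _) (yes _) = ≡.refl
[]-× (yes _) (no _) = ≡.refl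
[]-× (no _) (yes _) = ≡.refl
[]-× (no _) (no _) = ≡.refl

module _ {a} {A : Set a} where

  sumList : (A → ℤ) → List A → ℤ
  sumList f []       = 0ℤ
  sumList f (x ∷ xs) = f x +ℤ sumList f xs

  sumList-cong : ∀ {f g} → (∀ x → f x ≡ g x) → ∀ xs → sumList f xs ≡ sumList g xs
  sumList-cong eq []       = ≡.refl
  sumList-cong eq (x ∷ xs) = ≡.cong₂ _+ℤ_ (eq x) (sumList-cong eq xs)

  sumList-congᴬ : ∀ {f g} {xs} → All (λ x → f x ≡ g x) xs → sumList f xs ≡ sumList g xs
  sumList-congᴬ []         = ≡.refl
  sumList-congᴬ (eq ∷ eqs) = ≡.cong₂ _+ℤ_ eq (sumList-congᴬ eqs)

  sumList-+ : ∀ f g xs → sumList (λ x → f x +ℤ g x) xs ≡ sumList f xs +ℤ sumList g xs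
  sumList-+ f g []       = ≡.refl
  sumList-+ f g (x ∷ xs) rewrite sumList-+ f g xs = interchange (f x) (g x) (sumList f xs) (sumList g xs)
    where
    interchange : ∀ a b c d → (a +ℤ b) +ℤ (c +ℤ d) ≡ (a +ℤ c) +ℤ (b +ℤ d)
    interchange = solve-∀

  sumList-0 : ∀ xs → sumList (λ _ → 0ℤ) xs ≡ 0ℤ
  sumList-0 []       = ≡.refl
  sumList-0 (x ∷ xs) = ≡.trans (ℤ.+-identityˡ _) (sumList-0 xs)

  sumList-*ˡ : ∀ k f xs → sumList (λ x → k *ℤ f x) xs ≡ k *ℤ sumList f xs
  sumList-*ˡ k f []       = ≡.sym (ℤ.*-zeroʳ k)
  sumList-*ˡ k f (x ∷ xs) = ≡.trans (≡.cong (k *ℤ f x +ℤ_) (sumList-*ˡ k f xs)) (≡.sym (ℤ.*-distribˡ-+ k (f x) _))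

  sumList-*ʳ : ∀ k f xs → sumList (λ x → f x *ℤ k) xs ≡ sumList f xs *ℤ k
  sumList-*ʳ k f []       = ≡.refl
  sumList-*ʳ k f (x ∷ xs) = ≡.trans (≡.cong (f x *ℤ k +ℤ_) (sumList-*ʳ k f xs)) (≡.sym (ℤ.*-distribʳ-+ k (f x) _))

  sumList-++ : ∀ f xs ys → sumList f (xs ++ ys) ≡ sumList f xs +ℤ sumList f ys
  sumList-++ f []       ys = ≡.sym (ℤ.+-identityˡ _)
  sumList-++ f (x ∷ xs) ys = ≡.trans (≡.cong (f x +ℤ_) (sumList-++ f xs ys)) (≡.sym (ℤ.+-assoc (f x) _ _))

  length-filter : ∀ {p} {P : Pred A p} (P? : Decidable P) xs →
                  + length (filter P? xs) ≡ sumList (λ x → [ P? x ]) xs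
  length-filter P? [] = ≡.refl
  length-filter P? (x ∷ xs) with P? x
  ... | yes _ = ≡.cong (1ℤ +ℤ_) (length-filter P? xs)
  ... | no  _ = ≡.trans (length-filter P? xs) (≡.sym (ℤ.+-identityˡ _))

sumList-map : ∀ {a b} {A : Set a} {B : Set b} (g : B → ℤ) (f : A → B) xs →
              sumList g (map f xs) ≡ sumList (g ∘ f) xs
sumList-map g f []       = ≡.refl
sumList-map g f (x ∷ xs) = ≡.cong (g (f x) +ℤ_) (sumList-map g f xs)

sumList-concatMap : ∀ {a b} {A : Set a} {B : Set b} (g : B → ℤ) (f : A → List B) xs →
                    sumList g (concatMap f xs) ≡ sumList (sumList g ∘ f) xs
sumList-concatMap g f []       = ≡.refl
sumList-concatMap g f (x ∷ xs) =
  ≡.trans (sumList-++ g (f x) _) (≡.cong (sumList g (f x) +ℤ_) (sumList-concatMap g f xs))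

sumList-swap : ∀ {a b} {A : Set a} {B : Set b} (g : A → B → ℤ) xs ys →
  sumList (λ x → sumList (g x) ys) xs ≡ sumList (λ y → sumList (λ x → g x y) xs) ys
sumList-swap g []       ys = ≡.sym (sumList-0 ys)
sumList-swap g (x ∷ xs) ys =
  ≡.trans (≡.cong (sumList (g x) ys +ℤ_) (sumList-swap g xs ys)) (≡.sym (sumList-+ (g x) _ ys))

sumList-tabulate : ∀ {a} {A : Set a} {n} (g : A → ℤ) (f : Fin n → A) →
                   sumList g (tabulate f) ≡ sumℤ (g ∘ f)
sumList-tabulate {n = zero}  g f = ≡.refl
sumList-tabulate {n = suc n} g f = ≡.cong (g (f zero) +ℤ_) (sumList-tabulate g (f ∘ suc))

module _ {a} {A : Set a} (_≟_ : DecidableEquality A) where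

  sumList-absent : ∀ (f : A → ℤ) x ys → All (x ≢_) ys → sumList (λ y → [ x ≟ y ] *ℤ f y) ys ≡ 0ℤ
  sumList-absent f x []       []       = ≡.refl
  sumList-absent f x (y ∷ ys) (n ∷ ns)
    rewrite []-no (x ≟ y) n | sumList-absent f x ys ns = ≡.refl

  sumList-δ : ∀ (f : A → ℤ) {x ys} → Unique ys → x List.∈ ys → sumList (λ y → [ x ≟ y ] *ℤ f y) ys ≡ f x
  sumList-δ f {x} {.x ∷ ys} (u ∷ us) (here ≡.refl)
    rewrite []-yes (x ≟ x) ≡.refl | sumList-absent f x ys u = ≡.trans (ℤ.+-identityʳ _) (ℤ.*-identityˡ _)
  sumList-δ f {x} {y ∷ ys} (u ∷ us) (there x∈)
    rewrite []-no (x ≟ y) (λ { ≡.refl → All.lookup u x∈ ≡.refl }) = ≡.trans (ℤ.+-identityˡ _) (sumList-δ f us x∈)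

  -- Double counting of the pairs (x, y) with x = y, x from the full list and y from the
  -- deduplicated one: each y is met k times, each x exactly once. With k = 12 it turns a sum over
  -- distinct blocks into a sum over affine maps.
  sumList-deduplicate : ∀ k (f : A → ℤ) xs →
    All (λ y → sumList (λ x → [ x ≟ y ]) xs ≡ k) xs →
    k *ℤ sumList f (deduplicate _≟_ xs) ≡ sumList f xs
  sumList-deduplicate k f xs mult = begin
    k *ℤ sumList f ys                                           ≡⟨ ≡.sym (sumList-*ˡ k f ys) ⟩
    sumList (λ y → k *ℤ f y) ys                                 ≡⟨ sumList-congᴬ (All.tabulate λ y∈ →
                                                                     ≡.cong (_*ℤ f _) (≡.sym (All.lookup mult (∈-deduplicate⁻ _≟_ xs y∈)))) ⟩
    sumList (λ y → sumList (λ x → [ x ≟ y ]) xs *ℤ f y) ys       ≡⟨ sumList-cong (λ y → ≡.sym (sumList-*ʳ (f y) _ xs)) ys ⟩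
    sumList (λ y → sumList (λ x → [ x ≟ y ] *ℤ f y) xs) ys       ≡⟨ sumList-swap (λ y x → [ x ≟ y ] *ℤ f y) ys xs ⟩
    sumList (λ x → sumList (λ y → [ x ≟ y ] *ℤ f y) ys) xs       ≡⟨ sumList-congᴬ (All.tabulate λ x∈ →
                                                                     sumList-δ f (deduplicate-! _≟_ xs) (∈-deduplicate⁺ _≟_ x∈)) ⟩
    sumList f xs                                                ∎
    where
    open ≡.≡-Reasoning
    ys = deduplicate _≟_ xs

-- Sums over a finite field, inverses, and the identity x^q = x

module FiniteFields {q : ℕ} {c ℓ : Level} (F : FiniteField q c ℓ) where
  open FiniteField F hiding (_-_; _≉_; zero)
  open SetoidReasoning setoid
  open Exp semiring using (^-congˡ; ^-homo-*; ^-assocʳ) renaming (_^_ to _^ᶠ_)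
  open RingProperties ring using (+-cancelˡ)

  index : Carrier → Fin q
  index x = proj₁ (enum-surjective x)

  enum-index : ∀ x → enum (index x) ≈ x
  enum-index x = proj₂ (enum-surjective x)

  index-enum : ∀ i → index (enum i) ≡ i
  index-enum i = enum-injective _ _ (enum-index (enum i))

  index-unique : ∀ {x y} → x ≈ y → index x ≡ index y
  index-unique x≈y = enum-injective _ _ (trans (enum-index _) (trans x≈y (sym (enum-index _))))

  module _ {a b} (M : CommutativeMonoid a b) where
    private module M = CommutativeMonoid M
    open CMSum M using (sum; sum-permute; sum-cong-≋)

    -- Stated for any commutative monoid because it is applied to integer sums, to sums in the field
    -- and to products in the field.
    sum-reindex : (g : Carrier → M.Carrier) → (∀ {x y} → x ≈ y → g x M.≈ g y) →
                  (φ ψ : Carrier → Carrier) →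
                  (∀ {x y} → x ≈ y → φ x ≈ φ y) → (∀ {x y} → x ≈ y → ψ x ≈ ψ y) →
                  (∀ x → φ (ψ x) ≈ x) → (∀ x → ψ (φ x) ≈ x) →
                  sum (g ∘ enum) M.≈ sum (g ∘ φ ∘ enum)
    sum-reindex g g-cong φ ψ φ-cong ψ-cong φψ ψφ = M.trans
      (sum-permute (g ∘ enum) (permutation
        (index ∘ φ ∘ enum) (index ∘ ψ ∘ enum)
        (λ i → ≡.trans (index-unique (trans (φ-cong (enum-index _)) (φψ (enum i)))) (index-enum i))
        (λ i → ≡.trans (index-unique (trans (ψ-cong (enum-index _)) (ψφ (enum i)))) (index-enum i))))
      (sum-cong-≋ (λ i → g-cong (enum-index (φ (enum i)))))

    sum-point : ∀ a (g : Carrier → M.Carrier) → (∀ {x y} → x ≈ y → g x M.≈ g y) →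
                (∀ x → ¬ x ≈ a → g x M.≈ M.ε) → sum (g ∘ enum) M.≈ g a
    sum-point a g g-cong off = M.trans
      (sum-single M (index a) (g ∘ enum)
        (λ i i≢a → off (enum i) (λ i≈a → i≢a (≡.trans (≡.sym (index-enum i)) (index-unique i≈a)))))
      (g-cong (enum-index a))

  ∑ : (Carrier → ℤ) → ℤ
  ∑ g = sumℤ (g ∘ enum)

  Congruent : (Carrier → ℤ) → Set (c ⊔ ℓ)
  Congruent g = ∀ {x y} → x ≈ y → g x ≡ g y

  ∑-cong : ∀ {g h : Carrier → ℤ} → (∀ x → g x ≡ h x) → ∑ g ≡ ∑ h
  ∑-cong eq = sum-cong-≗ (eq ∘ enum)

  ∑-reindex : ∀ {g} → Congruent g → (φ ψ : Carrier → Carrier) →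
              (∀ {x y} → x ≈ y → φ x ≈ φ y) → (∀ {x y} → x ≈ y → ψ x ≈ ψ y) →
              (∀ x → φ (ψ x) ≈ x) → (∀ x → ψ (φ x) ≈ x) → ∑ g ≡ ∑ (g ∘ φ)
  ∑-reindex {g} = sum-reindex ℤ.+-0-commutativeMonoid g

  ∑-swap : ∀ (g : Carrier → Carrier → ℤ) → ∑ (λ x → ∑ (g x)) ≡ ∑ (λ y → ∑ (λ x → g x y))
  ∑-swap g = ∑-comm (λ i j → g (enum i) (enum j))

  ∑-+ : ∀ (g h : Carrier → ℤ) → ∑ (λ x → g x +ℤ h x) ≡ ∑ g +ℤ ∑ h
  ∑-+ g h = ∑-distrib-+ (g ∘ enum) (h ∘ enum)

  ∑-*ˡ : ∀ k (g : Carrier → ℤ) → ∑ (λ x → k *ℤ g x) ≡ k *ℤ ∑ g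
  ∑-*ˡ k g = ≡.sym (*-distribˡ-sum k (g ∘ enum))

  ∑-*ʳ : ∀ k (g : Carrier → ℤ) → ∑ (λ x → g x *ℤ k) ≡ ∑ g *ℤ k
  ∑-*ʳ k g = ≡.sym (*-distribʳ-sum k (g ∘ enum))

  ∑-const : ∀ k → ∑ (λ _ → k) ≡ + q *ℤ k
  ∑-const k = go q
    where
    go : ∀ n → sumℤ {n} (λ _ → k) ≡ + n *ℤ k
    go zero    = ≡.refl
    go (suc n) = ≡.trans (≡.cong (k +ℤ_) (go n)) (≡.sym (ℤ.suc-* (+ n) k))

  ≟-cong : ∀ {x y x′ y′} → x ≈ x′ → y ≈ y′ → [ x ≟ y ] ≡ [ x′ ≟ y′ ]
  ≟-cong e f = []-cong (_ ≟ _) (_ ≟ _) (λ p → trans (sym e) (trans p f)) (λ p → trans e (trans p (sym f)))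

  ∑-δ : ∀ a {g} → Congruent g → ∑ (λ x → [ x ≟ a ] *ℤ g x) ≡ g a
  ∑-δ a {g} g-cong = ≡.trans
    (sum-point ℤ.+-0-commutativeMonoid a _ (λ e → ≡.cong₂ _*ℤ_ (≟-cong e refl) (g-cong e))
      (λ x x≉a → ≡.cong (_*ℤ g x) ([]-no (x ≟ a) x≉a)))
    (≡.trans (≡.cong (_*ℤ g a) ([]-yes (a ≟ a) refl)) (ℤ.*-identityˡ (g a)))

  ∑-δ₁ : ∀ a → ∑ (λ x → [ x ≟ a ]) ≡ 1ℤ
  ∑-δ₁ a = ≡.trans (∑-cong (λ x → ≡.sym (ℤ.*-identityʳ [ x ≟ a ]))) (∑-δ a {λ _ → 1ℤ} (λ _ → ≡.refl))

  *-cancelˡ : ∀ {a x y} → ¬ a ≈ 0# → a * x ≈ a * y → x ≈ y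
  *-cancelˡ {a} {x} {y} a≉0 eq with inverse a a≉0
  ... | b , ab≈1 = begin
    x           ≈⟨ sym (*-identityˡ x) ⟩
    1# * x      ≈⟨ *-congʳ (sym ba≈1) ⟩
    b * a * x   ≈⟨ *-assoc b a x ⟩
    b * (a * x) ≈⟨ *-congˡ eq ⟩
    b * (a * y) ≈⟨ sym (*-assoc b a y) ⟩
    b * a * y   ≈⟨ *-congʳ ba≈1 ⟩
    1# * y      ≈⟨ *-identityˡ y ⟩
    y           ∎
    where ba≈1 = trans (*-comm b a) ab≈1

  *-zero-split : ∀ {x y} → x * y ≈ 0# → x ≈ 0# ⊎ y ≈ 0#
  *-zero-split {x} {y} xy≈0 with x ≟ 0#
  ... | yes x≈0 = inj₁ x≈0
  ... | no  x≉0 = inj₂ (*-cancelˡ x≉0 (trans xy≈0 (sym (zeroʳ x))))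

  *-nonzero : ∀ {x y} → ¬ x ≈ 0# → ¬ y ≈ 0# → ¬ x * y ≈ 0#
  *-nonzero x≉0 y≉0 xy≈0 with *-zero-split xy≈0
  ... | inj₁ x≈0 = x≉0 x≈0
  ... | inj₂ y≈0 = y≉0 y≈0

  infix 9 _⁻¹
  -- Made total by 0⁻¹ = 0, so that inversion permutes the whole field and sums need not be
  -- restricted to nonzero elements.
  _⁻¹ : Carrier → Carrier
  x ⁻¹ with x ≟ 0#
  ... | yes _   = 0#
  ... | no  x≉0 = proj₁ (inverse x x≉0)

  ⁻¹-inverse : ∀ {x} → ¬ x ≈ 0# → x * x ⁻¹ ≈ 1#
  ⁻¹-inverse {x} x≉0 with x ≟ 0#
  ... | yes x≈0 = contradiction x≈0 x≉0
  ... | no  x≉0 = proj₂ (inverse x x≉0)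

  0⁻¹ : ∀ {x} → x ≈ 0# → x ⁻¹ ≈ 0#
  0⁻¹ {x} x≈0 with x ≟ 0#
  ... | yes _   = refl
  ... | no  x≉0 = contradiction x≈0 x≉0

  ⁻¹-unique : ∀ {x y} → x * y ≈ 1# → y ≈ x ⁻¹
  ⁻¹-unique {x} {y} xy≈1 = *-cancelˡ x≉0 (trans xy≈1 (sym (⁻¹-inverse x≉0)))
    where
    x≉0 : ¬ x ≈ 0#
    x≉0 x≈0 = 1≉0 (trans (sym xy≈1) (trans (*-congʳ x≈0) (zeroˡ y)))

  ⁻¹-cong : ∀ {x y} → x ≈ y → x ⁻¹ ≈ y ⁻¹
  ⁻¹-cong {x} {y} x≈y with x ≟ 0#
  ... | yes x≈0 = sym (0⁻¹ (trans (sym x≈y) x≈0))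
  ... | no  x≉0 = ⁻¹-unique (trans (*-congʳ (sym x≈y)) (proj₂ (inverse x x≉0)))

  ⁻¹-nonzero : ∀ {x} → ¬ x ≈ 0# → ¬ x ⁻¹ ≈ 0#
  ⁻¹-nonzero {x} x≉0 eq = 1≉0 (trans (sym (⁻¹-inverse x≉0)) (trans (*-congˡ eq) (zeroʳ x)))

  pow≡^ : ∀ x n → pow F x n ≡ x ^ᶠ n
  pow≡^ x zero    = ≡.refl
  pow≡^ x (suc n) = ≡.cong (x *_) (pow≡^ x n)

  pow-cong : ∀ n {x y} → x ≈ y → pow F x n ≈ pow F y n
  pow-cong n {x} {y} x≈y rewrite pow≡^ x n | pow≡^ y n = ^-congˡ n x≈y

  pow-+ : ∀ x m n → pow F x (m ℕ.+ n) ≈ pow F x m * pow F x n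
  pow-+ x m n rewrite pow≡^ x (m ℕ.+ n) | pow≡^ x m | pow≡^ x n = ^-homo-* x m n

  pow-* : ∀ x m n → pow F (pow F x m) n ≈ pow F x (m ℕ.* n)
  pow-* x m n rewrite pow≡^ x m | pow≡^ (x ^ᶠ m) n | pow≡^ x (m ℕ.* n) = ^-assocʳ x m n

  pow-1 : ∀ n → pow F 1# n ≈ 1#
  pow-1 zero    = refl
  pow-1 (suc n) = trans (*-identityˡ _) (pow-1 n)

  pow-nonzero : ∀ {x} n → ¬ x ≈ 0# → ¬ pow F x n ≈ 0#
  pow-nonzero zero    x≉0 = 1≉0
  pow-nonzero (suc n) x≉0 = *-nonzero x≉0 (pow-nonzero n x≉0)

  -- Multiplication by a ≠ 0 permutes the nonzero elements, so a^(q-1) = 1 after cancelling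
  -- their product; inserting the factor a at x = 0 makes the exponent q.
  pow-q : ∀ a → pow F a q ≈ a
  pow-q a with a ≟ 0#
  ... | yes a≈0 = trans (pow-cong q a≈0) (trans (pow-0 (index 0#)) (sym a≈0))
    where
    pow-0 : ∀ {n} → Fin n → pow F 0# n ≈ 0#
    pow-0 {suc n} _ = zeroˡ _
  ... | no a≉0 = *-cancelˡ {Π u} (Π-nonzero u u-nonzero) (begin
    Π u * pow F a q           ≈⟨ *-congˡ (sym (Π-const q)) ⟩
    Π u * Π (λ _ → a)         ≈⟨ *-comm _ _ ⟩
    Π (λ _ → a) * Π u         ≈⟨ sym (∑-distrib (λ _ → a) (u ∘ enum)) ⟩
    Π (λ x → a * u x)         ≈⟨ sum-cong-≋ (λ i → sym (scale (enum i))) ⟩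
    Π (λ x → u (a * x) * v x) ≈⟨ ∑-distrib (λ i → u (a * enum i)) (v ∘ enum) ⟩
    Π (λ x → u (a * x)) * Π v ≈⟨ *-congʳ (sym (sum-reindex *-commutativeMonoid u u-cong (a *_) (a ⁻¹ *_) *-congˡ *-congˡ
                                   (λ x → trans (sym (*-assoc a (a ⁻¹) x)) (trans (*-congʳ (⁻¹-inverse a≉0)) (*-identityˡ x)))
                                   (λ x → trans (sym (*-assoc (a ⁻¹) a x)) (trans (*-congʳ (trans (*-comm (a ⁻¹) a) (⁻¹-inverse a≉0))) (*-identityˡ x))))) ⟩
    Π u * Π v                 ≈⟨ *-congˡ (sum-point *-commutativeMonoid 0# v v-cong v-off) ⟩
    Π u * v 0#                ≈⟨ *-congˡ (v-on refl) ⟩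
    Π u * a                   ∎)
    where
    open CMSum *-commutativeMonoid using (sum; sum-cong-≋) renaming (∑-distrib-+ to ∑-distrib)
    Π : (Carrier → Carrier) → Carrier
    Π g = sum (g ∘ enum)
    u v : Carrier → Carrier
    u x = if does (x ≟ 0#) then 1# else x
    v x = if does (x ≟ 0#) then a else 1#
    u-on : ∀ {x} → x ≈ 0# → u x ≈ 1#
    u-on {x} x≈0 with x ≟ 0#
    ... | yes _   = refl
    ... | no  x≉0 = contradiction x≈0 x≉0
    u-off : ∀ {x} → ¬ x ≈ 0# → u x ≈ x
    u-off {x} x≉0 with x ≟ 0#
    ... | yes x≈0 = contradiction x≈0 x≉0
    ... | no  _   = refl
    v-on : ∀ {x} → x ≈ 0# → v x ≈ a
    v-on {x} x≈0 with x ≟ 0#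
    ... | yes _   = refl
    ... | no  x≉0 = contradiction x≈0 x≉0
    v-off : ∀ x → ¬ x ≈ 0# → v x ≈ 1#
    v-off x x≉0 with x ≟ 0#
    ... | yes x≈0 = contradiction x≈0 x≉0
    ... | no  _   = refl
    u-cong : ∀ {x y} → x ≈ y → u x ≈ u y
    u-cong {x} {y} x≈y with y ≟ 0#
    ... | yes y≈0 = u-on (trans x≈y y≈0)
    ... | no  y≉0 = trans (u-off (λ x≈0 → y≉0 (trans (sym x≈y) x≈0))) x≈y
    v-cong : ∀ {x y} → x ≈ y → v x ≈ v y
    v-cong {x} {y} x≈y with y ≟ 0#
    ... | yes y≈0 = v-on (trans x≈y y≈0)
    ... | no  y≉0 = v-off x (λ x≈0 → y≉0 (trans (sym x≈y) x≈0))
    scale : ∀ x → u (a * x) * v x ≈ a * u x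
    scale x with x ≟ 0#
    ... | yes x≈0 = trans (*-congʳ (u-on (trans (*-congˡ x≈0) (zeroʳ a)))) (*-comm 1# a)
    ... | no  x≉0 = trans (*-identityʳ _) (u-off (*-nonzero a≉0 x≉0))
    u-nonzero : ∀ x → ¬ u x ≈ 0#
    u-nonzero x with x ≟ 0#
    ... | yes _   = 1≉0
    ... | no  x≉0 = x≉0
    Π-nonzero : ∀ g → (∀ x → ¬ g x ≈ 0#) → ¬ Π g ≈ 0#
    Π-nonzero g g≉0 = go (λ i → g≉0 (enum i))
      where
      go : ∀ {n} {t : Fin n → Carrier} → (∀ i → ¬ t i ≈ 0#) → ¬ sum t ≈ 0#
      go {zero}  _ = 1≉0
      go {suc n} t≉0 = *-nonzero (t≉0 zero) (go (t≉0 ∘ suc))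
    Π-const : ∀ n → sum {n} (λ _ → a) ≈ pow F a n
    Π-const zero    = refl
    Π-const (suc n) = *-congˡ (Π-const n)

  open Mult semiring using () renaming (_×_ to _×ᶠ_)

  -- Translation by 1 permutes F, so the sum s of all elements satisfies s = s + q·1.
  q×1≈0 : q ×ᶠ 1# ≈ 0#
  q×1≈0 = +-cancelˡ (sum enum) _ _ (begin
    sum enum + q ×ᶠ 1#          ≈⟨ +-congˡ (sym (sum-replicate′ q)) ⟩
    sum enum + sum {q} (λ _ → 1#) ≈⟨ sym (∑-distrib enum (λ _ → 1#)) ⟩
    sum (λ i → enum i + 1#)      ≈⟨ sym (sum-reindex +-commutativeMonoid (λ x → x) (λ e → e) (_+ 1#) (_+ - 1#) +-congʳ +-congʳ
                                      (λ x → trans (+-assoc x (- 1#) 1#) (trans (+-congˡ (-‿inverseˡ 1#)) (+-identityʳ x)))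
                                      (λ x → trans (+-assoc x 1# (- 1#)) (trans (+-congˡ (-‿inverseʳ 1#)) (+-identityʳ x)))) ⟩
    sum enum                     ≈⟨ sym (+-identityʳ _) ⟩
    sum enum + 0#                ∎)
    where
    open CMSum +-commutativeMonoid using (sum) renaming (∑-distrib-+ to ∑-distrib; sum-replicate to sum-replicate′)

-- Characteristic 2, roots of polynomials, and the trace

module BinaryFields (n : ℕ) {c ℓ : Level} (F : FiniteField (2 ^ suc n) c ℓ) where
  open FiniteField F hiding (_-_; _≉_; zero)
  open FiniteFields F
  open SetoidReasoning setoid
  open Mult semiring using (×1-homo-*) renaming (_×_ to _×ᶠ_)
  open RingProperties ring using (+-cancelʳ; +-cancelˡ)

  -- The multiple q·1 is a power of 1 + 1. If 1 + 1 were nonzero, so would be q·1, as there are no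
  -- zero divisors.
  1+1≈0 : 1# + 1# ≈ 0#
  1+1≈0 with (1# + 1#) ≟ 0#
  ... | yes eq = eq
  ... | no  2≉0 = contradiction q×1≈0 (2^n×1≉0 (suc n))
    where
    2^n×1≉0 : ∀ n → ¬ (2 ^ n) ×ᶠ 1# ≈ 0#
    2^n×1≉0 zero    eq = 1≉0 (trans (sym (+-identityʳ 1#)) eq)
    2^n×1≉0 (suc n) eq = *-nonzero (λ e → 2≉0 (trans (+-congˡ (sym (+-identityʳ 1#))) e)) (2^n×1≉0 n)
      (trans (sym (×1-homo-* 2 (2 ^ n))) eq)

  x+x≈0 : ∀ x → x + x ≈ 0#
  x+x≈0 x = begin
    x + x           ≈⟨ sym (+-cong (*-identityʳ x) (*-identityʳ x)) ⟩
    x * 1# + x * 1# ≈⟨ sym (distribˡ x 1# 1#) ⟩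
    x * (1# + 1#)   ≈⟨ *-congˡ 1+1≈0 ⟩
    x * 0#          ≈⟨ zeroʳ x ⟩
    0#              ∎

  -x≈x : ∀ x → - x ≈ x
  -x≈x x = +-cancelʳ x (- x) x (trans (-‿inverseˡ x) (sym (x+x≈0 x)))

  x+y≈0⇒x≈y : ∀ {x y} → x + y ≈ 0# → x ≈ y
  x+y≈0⇒x≈y {x} {y} eq = +-cancelʳ y x y (trans eq (sym (x+x≈0 y)))

  x≈y⇒x+y≈0 : ∀ {x y} → x ≈ y → x + y ≈ 0#
  x≈y⇒x+y≈0 {x} {y} eq = trans (+-congʳ eq) (x+x≈0 y)

  private
    𝔽₂ : RawRing _ _
    𝔽₂ = CommutativeRing.rawRing Bool.xor-∧-commutativeRing

    embed : Bool → Carrier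
    embed b = if b then 1# else 0#

    embed-homo : 𝔽₂ -Raw-AlmostCommutative⟶ fromCommutativeRing commRing
    embed-homo = record
      { ⟦_⟧    = embed
      ; +-homo = λ { true true → sym 1+1≈0 ; true false → sym (+-identityʳ 1#) ; false b → sym (+-identityˡ (embed b)) }
      ; *-homo = λ { true b → sym (*-identityˡ (embed b)) ; false b → sym (zeroˡ (embed b)) }
      ; -‿homo = λ b → sym (-x≈x (embed b))
      ; 0-homo = refl
      ; 1-homo = refl
      }

    embed-≟ : ∀ a b → Maybe (embed a ≈ embed b)
    embed-≟ a b with a Bool.≟ b
    ... | yes ≡.refl = just refl
    ... | no  _      = nothing

  -- Coefficients in GF(2), so that identities using 1 + 1 = 0 are solved automatically.
  module Char2Solver = RingSolver 𝔽₂ (fromCommutativeRing commRing) embed-homo embed-≟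
  open Char2Solver using (solve; _:=_; _:+_; _:*_; con)

  -- Poly l n f: f is a polynomial function of formal degree n with coefficient l at xⁿ.
  data Poly (l : Carrier) : ℕ → (Carrier → Carrier) → Set (c ⊔ ℓ) where
    const : ∀ {f} → (∀ x → f x ≈ l) → Poly l 0 f
    _∷x*_⟨_⟩ : ∀ {n f g} a → Poly l n g → (∀ x → f x ≈ a + x * g x) → Poly l (suc n) f

  Poly-resp : ∀ {l n f g} → (∀ x → f x ≈ g x) → Poly l n f → Poly l n g
  Poly-resp eq (const f≈l)      = const (λ x → trans (sym (eq x)) (f≈l x))
  Poly-resp eq (a ∷x* p ⟨ e ⟩) = a ∷x* p ⟨ (λ x → trans (sym (eq x)) (e x)) ⟩

  Poly-lead : ∀ {l l′ n f} → l ≈ l′ → Poly l n f → Poly l′ n f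
  Poly-lead eq (const f≈l)      = const (λ x → trans (f≈l x) eq)
  Poly-lead eq (a ∷x* p ⟨ e ⟩) = a ∷x* Poly-lead eq p ⟨ e ⟩

  -- `Poly-+` needs equal formal degrees; padding with a zero leading coefficient lets lower terms
  -- be added without losing monicity.
  Poly-raise : ∀ {l n f} → Poly l n f → Poly 0# (suc n) f
  Poly-raise {l} (const f≈l) = l ∷x* const (λ _ → refl)
    ⟨ (λ x → trans (f≈l x) (sym (trans (+-congˡ (zeroʳ x)) (+-identityʳ l)))) ⟩
  Poly-raise (a ∷x* p ⟨ e ⟩) = a ∷x* Poly-raise p ⟨ e ⟩

  Poly-raise-+ : ∀ {l n f} k → Poly l n f → Poly 0# (suc k ℕ.+ n) f
  Poly-raise-+ zero    p = Poly-raise p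
  Poly-raise-+ (suc k) p = Poly-raise (Poly-raise-+ k p)

  Poly-pow : ∀ n → Poly 1# n (λ x → pow F x n)
  Poly-pow zero    = const (λ _ → refl)
  Poly-pow (suc n) = 0# ∷x* Poly-pow n ⟨ (λ x → sym (+-identityˡ _)) ⟩

  Poly-+ : ∀ {l l′ n f g} → Poly l n f → Poly l′ n g → Poly (l + l′) n (λ x → f x + g x)
  Poly-+ (const f≈l) (const g≈l′) = const (λ x → +-cong (f≈l x) (g≈l′ x))
  Poly-+ (_∷x*_⟨_⟩ {g = f′} a p e) (_∷x*_⟨_⟩ {g = g′} b r d) = (a + b) ∷x* Poly-+ p r
    ⟨ (λ x → trans (+-cong (e x) (d x)) (lemma a b x (f′ x) (g′ x))) ⟩
    where
    lemma : ∀ a b x u v → (a + x * u) + (b + x * v) ≈ a + b + x * (u + v)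
    lemma = solve 5 (λ a b x u v → (a :+ x :* u) :+ (b :+ x :* v) := a :+ b :+ x :* (u :+ v)) refl

  -- Synthetic division by x - r on the Horner form, with minus written as plus. The quotient keeps
  -- the leading coefficient, so monic polynomials stay monic.
  Poly-divide : ∀ {l n f} r → Poly l (suc n) f →
                Σ (Carrier → Carrier) λ g → Poly l n g × (∀ x → f x + f r ≈ (x + r) * g x)
  Poly-divide {l} {zero} {f} r (a ∷x* const g≈l ⟨ e ⟩) = (λ _ → l) , const (λ _ → refl) , λ x →
    trans (+-cong (trans (e x) (+-congˡ (*-congˡ (g≈l x)))) (trans (e r) (+-congˡ (*-congˡ (g≈l r)))))
      (lemma a x r l)
    where
    lemma : ∀ a x r l → (a + x * l) + (a + r * l) ≈ (x + r) * l
    lemma = solve 4 (λ a x r l → (a :+ x :* l) :+ (a :+ r :* l) := (x :+ r) :* l) refl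
  Poly-divide {l} {suc n} {f} r (_∷x*_⟨_⟩ {g = g} a p e) with Poly-divide r p
  ... | h , hp , eq = (λ x → g r + x * h x) , g r ∷x* hp ⟨ (λ _ → refl) ⟩ , λ x → begin
    f x + f r                               ≈⟨ +-cong (e x) (e r) ⟩
    (a + x * g x) + (a + r * g r)           ≈⟨ lemma₁ a x r (g x) (g r) ⟩
    x * (g x + g r) + (x + r) * g r         ≈⟨ +-congʳ (*-congˡ (eq x)) ⟩
    x * ((x + r) * h x) + (x + r) * g r     ≈⟨ lemma₂ x r (h x) (g r) ⟩
    (x + r) * (g r + x * h x)               ∎
    where
    lemma₁ : ∀ a x r u v → (a + x * u) + (a + r * v) ≈ x * (u + v) + (x + r) * v
    lemma₁ = solve 5 (λ a x r u v → (a :+ x :* u) :+ (a :+ r :* v) := x :* (u :+ v) :+ (x :+ r) :* v) refl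
    lemma₂ : ∀ x r u v → x * ((x + r) * u) + (x + r) * v ≈ (x + r) * (v + x * u)
    lemma₂ = solve 4 (λ x r u v → x :* ((x :+ r) :* u) :+ (x :+ r) :* v := (x :+ r) :* (v :+ x :* u)) refl

  -- Dividing out the first root leaves a monic quotient that vanishes at all the others, because
  -- these differ from it; the descent ends at the constant 1.
  Poly-roots : ∀ {n f} → Poly 1# n f → (r : Fin (suc n) → Carrier) →
               (∀ i j → r i ≈ r j → i ≡ j) → ¬ (∀ i → f (r i) ≈ 0#)
  Poly-roots (const f≈1) r inj root = 1≉0 (trans (sym (f≈1 (r zero))) (root zero))
  Poly-roots {suc n} {f} p r inj root with Poly-divide (r zero) p
  ... | g , gp , eq = Poly-roots gp (r ∘ suc) (λ i j e → Fin.suc-injective (inj _ _ e)) λ i →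
    case (*-zero-split (trans (sym (eq (r (suc i)))) (trans (+-cong (root (suc i)) (root zero)) (+-identityʳ 0#))))
    where
    case : ∀ {i} → r (suc i) + r zero ≈ 0# ⊎ g (r (suc i)) ≈ 0# → g (r (suc i)) ≈ 0#
    case (inj₂ g≈0) = g≈0
    case (inj₁ d≈0) with inj _ _ (x+y≈0⇒x≈y d≈0)
    ... | ()

  Poly-nonroot : ∀ {d f} → Poly 1# d f → d ℕ.< 2 ^ suc n → ∃ λ x → ¬ f x ≈ 0#
  Poly-nonroot {d} {f} p d<q with Fin.any? (λ i → ¬? (f (enum i) ≟ 0#))
  ... | yes (i , fi≉0) = enum i , fi≉0
  -- A function with no nonroot would vanish at the first d + 1 ≤ q enumerated elements.
  ... | no  none = contradiction
    (λ i → root (inject≤ i d<q))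
    (Poly-roots p (λ i → enum (inject≤ i d<q)) (λ i j e → Fin.inject≤-injective d<q d<q i j (enum-injective _ _ e)))
    where
    root : ∀ i → f (enum i) ≈ 0#
    root i with f (enum i) ≟ 0#
    ... | yes fi≈0 = fi≈0
    ... | no  fi≉0 = contradiction (i , fi≉0) none

  pow-2^suc : ∀ x i → pow F x (2 ^ suc i) ≈ pow F x (2 ^ i) * pow F x (2 ^ i)
  pow-2^suc x i = trans (pow-+ x (2 ^ i) (2 ^ i ℕ.+ 0))
    (*-congˡ (reflexive (≡.cong (pow F x) (ℕ.+-identityʳ (2 ^ i)))))

  pow-square : ∀ x i → pow F (x * x) (2 ^ i) ≈ pow F x (2 ^ suc i)
  pow-square x i = trans (pow-cong (2 ^ i) (*-congˡ (sym (*-identityʳ x)))) (pow-* x 2 (2 ^ i))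

  pow-2^-+ : ∀ x y i → pow F (x + y) (2 ^ i) ≈ pow F x (2 ^ i) + pow F y (2 ^ i)
  pow-2^-+ x y zero    = distribʳ 1# x y
  pow-2^-+ x y (suc i) = begin
    pow F (x + y) (2 ^ suc i)                                    ≈⟨ pow-2^suc (x + y) i ⟩
    pow F (x + y) (2 ^ i) * pow F (x + y) (2 ^ i)                ≈⟨ *-cong (pow-2^-+ x y i) (pow-2^-+ x y i) ⟩
    (u + v) * (u + v)                                            ≈⟨ solve 2 (λ u v → (u :+ v) :* (u :+ v) := u :* u :+ v :* v) refl u v ⟩
    u * u + v * v                                                ≈⟨ sym (+-cong (pow-2^suc x i) (pow-2^suc y i)) ⟩
    pow F x (2 ^ suc i) + pow F y (2 ^ suc i)                    ∎
    where
    u = pow F x (2 ^ i)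
    v = pow F y (2 ^ i)

  Tr-cong : ∀ i {x y} → x ≈ y → Tr F i x ≈ Tr F i y
  Tr-cong zero    x≈y = refl
  Tr-cong (suc i) x≈y = +-cong (Tr-cong i x≈y) (pow-cong (2 ^ i) x≈y)

  Tr-+ : ∀ i x y → Tr F i (x + y) ≈ Tr F i x + Tr F i y
  Tr-+ zero    x y = sym (+-identityʳ 0#)
  Tr-+ (suc i) x y = trans (+-cong (Tr-+ i x y) (pow-2^-+ x y i))
    (solve 4 (λ a b u v → (a :+ b) :+ (u :+ v) := (a :+ u) :+ (b :+ v)) refl _ _ _ _)

  Tr-square : ∀ i x → Tr F i x * Tr F i x ≈ Tr F i (x * x)
  Tr-square zero    x = zeroˡ 0#
  Tr-square (suc i) x = begin
    (t + u) * (t + u)                    ≈⟨ solve 2 (λ t u → (t :+ u) :* (t :+ u) := t :* t :+ u :* u) refl t u ⟩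
    t * t + u * u                        ≈⟨ +-cong (Tr-square i x) (trans (sym (pow-2^suc x i)) (sym (pow-square x i))) ⟩
    Tr F i (x * x) + pow F (x * x) (2 ^ i) ∎
    where
    t = Tr F i x
    u = pow F x (2 ^ i)

  -- Squaring moves every summand of the trace to the next one, so only the two ends differ. At i =
  -- m they agree, since x^q = x.
  Tr-telescope : ∀ i x → Tr F i (x * x) + x ≈ Tr F i x + pow F x (2 ^ i)
  Tr-telescope zero    x = +-congˡ (sym (*-identityʳ x))
  Tr-telescope (suc i) x = begin
    (Tr F i (x * x) + pow F (x * x) (2 ^ i)) + x ≈⟨ solve 3 (λ a b c → (a :+ b) :+ c := (a :+ c) :+ b) refl _ _ x ⟩
    (Tr F i (x * x) + x) + pow F (x * x) (2 ^ i) ≈⟨ +-cong (Tr-telescope i x) (pow-square x i) ⟩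
    Tr F (suc i) x + pow F x (2 ^ suc i)         ∎

  -- The last summand dominates: all earlier ones have degree at most half of 2^i and are padded up
  -- to it.
  Tr-Poly : ∀ i → Poly 1# (2 ^ i) (Tr F (suc i))
  Tr-Poly i = Poly-lead (+-identityˡ 1#) (Poly-+ (lower i) (Poly-pow (2 ^ i)))
    where
    raise : ∀ {f k} → 0 ℕ.< k → Poly 1# k f → Poly 0# (k ℕ.+ (k ℕ.+ 0)) f
    raise {f} {suc k} _ p = ≡.subst (λ d → Poly 0# d f)
      (≡.trans (ℕ.+-comm (suc k) (suc k)) (≡.cong (suc k ℕ.+_) (≡.sym (ℕ.+-identityʳ (suc k))))) (Poly-raise-+ k p)
    lower : ∀ i → Poly 0# (2 ^ i) (Tr F i)
    -- The empty trace is the zero constant, padded to formal degree 1 = 2⁰.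
    lower zero    = Poly-raise (const (λ _ → refl))
    lower (suc i) = raise (ℕ.m^n>0 2 i) (Tr-Poly i)

  T : Carrier → Carrier
  T = Tr F (suc n)

  T-cong : ∀ {x y} → x ≈ y → T x ≈ T y
  T-cong = Tr-cong (suc n)

  T-+ : ∀ x y → T (x + y) ≈ T x + T y
  T-+ = Tr-+ (suc n)

  T-0 : T 0# ≈ 0#
  T-0 = begin
    T 0#        ≈⟨ T-cong (sym (+-identityʳ 0#)) ⟩
    T (0# + 0#) ≈⟨ T-+ 0# 0# ⟩
    T 0# + T 0# ≈⟨ x+x≈0 (T 0#) ⟩
    0#          ∎

  T-square : ∀ x → T (x * x) ≈ T x
  T-square x = +-cancelʳ x _ _ (trans (Tr-telescope (suc n) x) (+-congˡ (pow-q x)))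

  -- Since Tr(x)² = Tr(x²) = Tr(x), the trace is a root of t² + t.
  T-binary : ∀ x → T x ≈ 0# ⊎ T x ≈ 1#
  T-binary x with *-zero-split {T x} {T x + 1#} (begin
    T x * (T x + 1#)      ≈⟨ solve 1 (λ t → t :* (t :+ con true) := t :* t :+ t) refl (T x) ⟩
    T x * T x + T x       ≈⟨ +-congʳ (trans (Tr-square (suc n) x) (T-square x)) ⟩
    T x + T x             ≈⟨ x+x≈0 (T x) ⟩
    0#                    ∎)
  ... | inj₁ eq = inj₁ eq
  ... | inj₂ eq = inj₂ (x+y≈0⇒x≈y eq)

  abstract
    -- The trace is monic of degree q/2 and therefore cannot vanish on all q elements.
    trace-one : ∃ λ t → T t ≈ 1#
    trace-one with Poly-nonroot (Tr-Poly n) (ℕ.^-monoʳ-< 2 (ℕ.s≤s (ℕ.s≤s ℕ.z≤n)) (ℕ.n<1+n n))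
    ... | t , Tt≉0 with T-binary t
    ...   | inj₁ Tt≈0 = contradiction Tt≈0 Tt≉0
    ...   | inj₂ Tt≈1 = t , Tt≈1

    square-onto : ∀ x → ∃ λ y → y * y ≈ x
    square-onto x = pow F x (2 ^ n) , trans (sym (pow-2^suc x n)) (pow-q x)

  -- Every element is a square, so y² can be chosen as t/z with Tr(t) = 1. The square is there
  -- because polarised forms are normalised to Tr(y² · L(x)).
  T-nondegenerate : ∀ {z} → ¬ z ≈ 0# → ∃ λ y → T (y * y * z) ≈ 1#
  T-nondegenerate {z} z≉0 = y , trans (T-cong (begin
    y * y * z      ≈⟨ *-congʳ (proj₂ (square-onto (t * z ⁻¹))) ⟩
    t * z ⁻¹ * z   ≈⟨ *-assoc t (z ⁻¹) z ⟩
    t * (z ⁻¹ * z) ≈⟨ *-congˡ (trans (*-comm (z ⁻¹) z) (⁻¹-inverse z≉0)) ⟩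
    t * 1#         ≈⟨ *-identityʳ t ⟩
    t              ∎)) (proj₂ trace-one)
    where
    t = proj₁ trace-one
    y = proj₁ (square-onto (t * z ⁻¹))

  -- The trace does not change under squaring, so the term e x² y may be replaced by its square;
  -- then y² factors out and the radical of the form can be read off.
  T-polar : ∀ e x y → T (e * (x * x * y + x * y * y)) ≈ T (y * y * (e * e * (x * x * x * x) + e * x))
  T-polar e x y = begin
    T (e * (x * x * y + x * y * y))             ≈⟨ T-cong (solve 3 (λ e x y → e :* (x :* x :* y :+ x :* y :* y) := e :* x :* x :* y :+ e :* x :* y :* y) refl e x y) ⟩
    T (e * x * x * y + e * x * y * y)           ≈⟨ T-+ _ _ ⟩
    T (e * x * x * y) + T (e * x * y * y)       ≈⟨ +-congʳ (sym (T-square _)) ⟩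
    T (e * x * x * y * (e * x * x * y)) + T (e * x * y * y) ≈⟨ sym (T-+ _ _) ⟩
    T (e * x * x * y * (e * x * x * y) + e * x * y * y) ≈⟨ T-cong (solve 3 (λ e x y →
        e :* x :* x :* y :* (e :* x :* x :* y) :+ e :* x :* y :* y := y :* y :* (e :* e :* (x :* x :* x :* x) :+ e :* x)) refl e x y) ⟩
    T (y * y * (e * e * (x * x * x * x) + e * x)) ∎

  T-polar₁ : ∀ x y → T (x * x * y + x * y * y) ≈ T (y * y * (x * x * x * x + x))
  T-polar₁ x y = trans (T-cong (sym (*-identityˡ _))) (trans (T-polar 1# x y)
    (T-cong (*-congˡ (solve 1 (λ x → con true :* con true :* (x :* x :* x :* x) :+ con true :* x := x :* x :* x :* x :+ x) refl x))))

-- The additive character and its orthogonality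

module Characters (n : ℕ) {c ℓ : Level} (F : FiniteField (2 ^ suc n) c ℓ) where
  open FiniteField F hiding (_-_; _≉_; zero)
  open FiniteFields F
  open BinaryFields n F
  open Char2Solver using (solve; _:=_; _:+_; _:*_)
  open ≡.≡-Reasoning

  χ : Carrier → ℤ
  χ x = if does (T x ≟ 1#) then -1ℤ else 1ℤ

  χ-1 : ∀ {x} → T x ≈ 1# → χ x ≡ -1ℤ
  χ-1 {x} eq with T x ≟ 1#
  ... | yes _  = ≡.refl
  ... | no neq = contradiction eq neq

  χ-0 : ∀ {x} → T x ≈ 0# → χ x ≡ 1ℤ
  χ-0 {x} eq with T x ≟ 1#
  ... | yes eq′ = contradiction (trans (sym eq′) eq) 1≉0
  ... | no _    = ≡.refl

  χ-cong : ∀ {x y} → x ≈ y → χ x ≡ χ y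
  χ-cong {x} {y} x≈y with T-binary y
  ... | inj₁ e = ≡.trans (χ-0 (trans (T-cong x≈y) e)) (≡.sym (χ-0 e))
  ... | inj₂ e = ≡.trans (χ-1 (trans (T-cong x≈y) e)) (≡.sym (χ-1 e))

  χ-+ : ∀ x y → χ (x + y) ≡ χ x *ℤ χ y
  χ-+ x y with T-binary x | T-binary y
  ... | inj₁ e | inj₁ d rewrite χ-0 {x} e | χ-0 {y} d = χ-0 (trans (T-+ x y) (trans (+-cong e d) (+-identityʳ 0#)))
  ... | inj₁ e | inj₂ d rewrite χ-0 {x} e | χ-1 {y} d = χ-1 (trans (T-+ x y) (trans (+-cong e d) (+-identityˡ 1#)))
  ... | inj₂ e | inj₁ d rewrite χ-1 {x} e | χ-0 {y} d = χ-1 (trans (T-+ x y) (trans (+-cong e d) (+-identityʳ 1#)))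
  ... | inj₂ e | inj₂ d rewrite χ-1 {x} e | χ-1 {y} d = χ-0 (trans (T-+ x y) (trans (+-cong e d) 1+1≈0))

  ∑-translate : ∀ {g} → Congruent g → ∀ t → ∑ g ≡ ∑ (λ x → g (x + t))
  ∑-translate g-cong t = ∑-reindex g-cong (_+ t) (_+ t) +-congʳ +-congʳ inv inv
    where
    inv : ∀ x → x + t + t ≈ x
    inv x = solve 2 (λ x t → x :+ t :+ t := x) refl x t

  -- Translating the summation variable by t multiplies the sum by χ(L t) = -1, so the sum equals
  -- its own negative.
  ∑χ-additive : ∀ (L : Carrier → Carrier) → (∀ {x y} → x ≈ y → L x ≈ L y) →
                (∀ x y → L (x + y) ≈ L x + L y) →
                ∀ t → T (L t) ≈ 1# → ∑ (χ ∘ L) ≡ 0ℤ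
  ∑χ-additive L L-cong L-+ t e = self-negative (begin
    ∑ (χ ∘ L)                     ≡⟨ ∑-translate (λ eq → χ-cong (L-cong eq)) t ⟩
    ∑ (λ x → χ (L (x + t)))       ≡⟨ ∑-cong (λ x → ≡.trans (χ-cong (L-+ x t)) (χ-+ (L x) (L t))) ⟩
    ∑ (λ x → χ (L x) *ℤ χ (L t))  ≡⟨ ∑-*ʳ (χ (L t)) (χ ∘ L) ⟩
    ∑ (χ ∘ L) *ℤ χ (L t)          ≡⟨ ≡.cong (∑ (χ ∘ L) *ℤ_) (χ-1 e) ⟩
    ∑ (χ ∘ L) *ℤ -1ℤ              ≡⟨ ≡.trans (ℤ.*-comm (∑ (χ ∘ L)) -1ℤ) (ℤ.-1*i≡-i _) ⟩
    -ℤ ∑ (χ ∘ L)                  ∎)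
    where
    self-negative : ∀ {i} → i ≡ -ℤ i → i ≡ 0ℤ
    self-negative {+ zero} _ = ≡.refl

  -- The exponent is additive in y. By `T-polar₁` its trace is identically 0 when x⁴ + x = 0, and
  -- otherwise takes the value 1, which makes the sum vanish.
  ∑χ-polar : ∀ x → ∑ (λ y → χ (x * x * y + x * y * y)) ≡ + (2 ^ suc n) *ℤ [ (x * x * x * x) ≟ x ]
  ∑χ-polar x with (x * x * x * x) ≟ x
  ... | yes x⁴≈x = ≡.trans (∑-cong (λ y → χ-0 (trans (T-polar₁ x y) (trans (T-cong (trans
            (*-congˡ (x≈y⇒x+y≈0 x⁴≈x)) (zeroʳ (y * y)))) T-0)))) (∑-const 1ℤ)
  ... | no x⁴≉x with T-nondegenerate (λ e → x⁴≉x (x+y≈0⇒x≈y e))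
  ...   | t , Tt≈1 = ≡.trans (∑χ-additive (λ y → x * x * y + x * y * y)
            (λ e → +-cong (*-congˡ e) (*-cong (*-congˡ e) e))
            (λ y z → solve 3 (λ x y z → x :* x :* (y :+ z) :+ x :* (y :+ z) :* (y :+ z) :=
               (x :* x :* y :+ x :* y :* y) :+ (x :* x :* z :+ x :* z :* z)) refl x y z)
            t (trans (T-polar₁ x t) Tt≈1)) (≡.sym (ℤ.*-zeroʳ (+ (2 ^ suc n))))

-- Powers of 4 and of -2 modulo 3

2^2h≡1+3N : ∀ h → ∃ λ N → 2 ^ (2 ℕ.* h) ≡ 1 ℕ.+ 3 ℕ.* N
2^2h≡1+3N zero    = 0 , ≡.refl
2^2h≡1+3N (suc h) with 2^2h≡1+3N h
... | N , eq = 1 ℕ.+ 4 ℕ.* N , ≡.trans (≡.cong (2 ^_) (ℕ.*-suc 2 h))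
  (≡.trans (≡.cong (λ k → 2 ℕ.* (2 ℕ.* k)) eq) (arith N))
  where
  arith : ∀ N → 2 ℕ.* (2 ℕ.* (1 ℕ.+ 3 ℕ.* N)) ≡ 1 ℕ.+ 3 ℕ.* (1 ℕ.+ 4 ℕ.* N)
  arith = ℕSolver.solve-∀

[-2]^h-square : ∀ h → (-[1+ 1 ] ^ℤ h) *ℤ (-[1+ 1 ] ^ℤ h) ≡ + (2 ^ (2 ℕ.* h))
[-2]^h-square zero    = ≡.refl
[-2]^h-square (suc h) = ≡.trans (arith (-[1+ 1 ] ^ℤ h)) (≡.trans (≡.cong (λ k → + 2 *ℤ (+ 2 *ℤ k)) ([-2]^h-square h))
  (≡.trans (≡.cong (+ 2 *ℤ_) (≡.sym (ℤ.pos-* 2 (2 ^ (2 ℕ.* h))))) (≡.trans (≡.sym (ℤ.pos-* 2 (2 ℕ.* 2 ^ (2 ℕ.* h)))) (≡.cong (λ k → + (2 ^ k)) (≡.sym (ℕ.*-suc 2 h))))))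
  where
  arith : ∀ k → (-[1+ 1 ] *ℤ k) *ℤ (-[1+ 1 ] *ℤ k) ≡ + 2 *ℤ (+ 2 *ℤ (k *ℤ k))
  arith = solve-∀

[-2]^h≡1[3] : ∀ h → ∃ λ t → -[1+ 1 ] ^ℤ h ≡ 1ℤ +ℤ + 3 *ℤ t
[-2]^h≡1[3] zero    = 0ℤ , ≡.refl
[-2]^h≡1[3] (suc h) with [-2]^h≡1[3] h
... | t , eq = -1ℤ +ℤ -[1+ 1 ] *ℤ t , ≡.trans (≡.cong (-[1+ 1 ] *ℤ_) eq) (arith t)
  where
  arith : ∀ t → -[1+ 1 ] *ℤ (1ℤ +ℤ + 3 *ℤ t) ≡ 1ℤ +ℤ + 3 *ℤ (-1ℤ +ℤ -[1+ 1 ] *ℤ t)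
  arith = solve-∀

-- Equal squares leave a = b or a + b = 0, and the latter fails because a + b ≡ 2 modulo 3. This
-- fixes the sign of the character sum.
square-root-unique-mod-3 : ∀ {a b} s t → a ≡ 1ℤ +ℤ + 3 *ℤ s → b ≡ 1ℤ +ℤ + 3 *ℤ t → a *ℤ a ≡ b *ℤ b → a ≡ b
square-root-unique-mod-3 {a} {b} s t a≡ b≡ sq =
  [ ℤ.i-j≡0⇒i≡j a b , (λ a+b≡0 → contradiction (≡.trans (≡.sym (≡.trans (≡.cong₂ _+ℤ_ a≡ b≡) (arith s t))) a+b≡0) (nonzero (s +ℤ t))) ]′
  (ℤ.i*j≡0⇒i≡0∨j≡0 (a - b) (≡.trans (factor a b) (ℤ.i≡j⇒i-j≡0 sq)))
  where
  factor : ∀ a b → (a - b) *ℤ (a +ℤ b) ≡ a *ℤ a - b *ℤ b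
  factor = solve-∀
  arith : ∀ s t → (1ℤ +ℤ + 3 *ℤ s) +ℤ (1ℤ +ℤ + 3 *ℤ t) ≡ + 2 +ℤ + 3 *ℤ (s +ℤ t)
  arith = solve-∀
  isolate : ∀ u → + 3 *ℤ u ≡ (+ 2 +ℤ + 3 *ℤ u) - + 2
  isolate = solve-∀
  3∤2 : ∀ w → 3 ℕ.* w ≢ 2
  3∤2 (suc w) eq with ≡.trans (≡.sym (ℕ.*-suc 3 w)) eq
  ... | ()
  nonzero : ∀ u → + 2 +ℤ + 3 *ℤ u ≢ 0ℤ
  nonzero u eq = 3∤2 ∣ u ∣ℤ (≡.trans (≡.sym (ℤ.abs-* (+ 3) u)) (≡.cong ∣_∣ℤ (≡.trans (isolate u) (≡.cong (_- + 2) eq))))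

-- Cube roots of unity, the cubic character sum, and the size of the base block

module EvenDegree (n h : ℕ) (even : suc n ≡ 2 ℕ.* h) {c ℓ : Level} (F : FiniteField (2 ^ suc n) c ℓ) where
  open FiniteField F hiding (_-_; _≉_; zero)
  open FiniteFields F
  open BinaryFields n F
  open Characters n F
  open Char2Solver using (solve; _:=_; _:+_; _:*_; _:^_; con)
  open ≡.≡-Reasoning
  open Mult semiring using (×1-homo-*; ×-congˡ) renaming (_×_ to _×ᶠ_)

  private
    q : ℕ
    q = 2 ^ suc n

  cube : Carrier → Carrier
  cube x = pow F x 3

  cube-cong : ∀ {x y} → x ≈ y → cube x ≈ cube y
  cube-cong = pow-cong 3

  cube-0 : cube 0# ≈ 0#
  cube-0 = zeroˡ _

  cube-* : ∀ x y → cube (x * y) ≈ cube x * cube y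
  cube-* = solve 2 (λ x y → (x :* y) :^ 3 := x :^ 3 :* y :^ 3) refl

  cube≈0 : ∀ {x} → cube x ≈ 0# → x ≈ 0#
  cube≈0 {x} eq with x ≟ 0#
  ... | yes x≈0 = x≈0
  ... | no  x≉0 = contradiction eq (pow-nonzero 3 x≉0)

  -- Every summand is 1, and there is an even number of them.
  T-1 : T 1# ≈ 0#
  T-1 = trans (count (suc n)) (trans (×-congˡ even) (trans (×1-homo-* 2 h)
    (trans (*-congʳ (trans (+-congˡ (+-identityʳ 1#)) 1+1≈0)) (zeroˡ _))))
    where
    count : ∀ i → Tr F i 1# ≈ i ×ᶠ 1#
    count zero    = refl
    count (suc i) = trans (+-cong (count i) (pow-1 (2 ^ i))) (+-comm _ 1#)

  primitive-cube-root : ∀ {w} → cube w ≈ 1# → ¬ w ≈ 1# → w * w + w + 1# ≈ 0#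
  primitive-cube-root {w} w³≈1 w≉1 with *-zero-split (trans (factor w) (x≈y⇒x+y≈0 w³≈1))
    where
    factor : ∀ w → (w + 1#) * (w * w + w + 1#) ≈ cube w + 1#
    factor = solve 1 (λ w → (w :+ con true) :* (w :* w :+ w :+ con true) := w :^ 3 :+ con true) refl
  ... | inj₁ e = contradiction (x+y≈0⇒x≈y e) w≉1
  ... | inj₂ e = e

  cube-pow≈1 : ∀ {x} N → 2 ^ suc n ≡ 1 ℕ.+ 3 ℕ.* N → ¬ x ≈ 0# → cube (pow F x N) ≈ 1#
  cube-pow≈1 {x} N q≡1+3N x≉0 = *-cancelˡ {x} x≉0 (trans (*-congˡ {x} (pow-* x N 3)) (trans
    (reflexive (≡.trans (≡.cong (λ d → x * pow F x d) (ℕ.*-comm N 3)) (≡.cong (pow F x) (≡.sym q≡1+3N))))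
    (trans (pow-q x) (sym (*-identityʳ x)))))

  -- With q = 1 + 3N, the polynomial x(x^N + 1) has degree N + 1 < q, hence a nonroot x,
  -- and x^N is a cube root of unity other than 1.
  cube-root-of-unity′ : (∃ λ N → 2 ^ (2 ℕ.* h) ≡ 1 ℕ.+ 3 ℕ.* N) →
                        ∃ λ ω → ω * ω + ω + 1# ≈ 0#
  -- N = 0 would mean q = 1.
  cube-root-of-unity′ (zero , eq) = contradiction (≡.trans (≡.cong (2 ^_) even) eq)
      (ℕ.>⇒≢ (ℕ.^-monoʳ-< 2 (ℕ.s≤s (ℕ.s≤s ℕ.z≤n)) {0} {suc n} (ℕ.s≤s ℕ.z≤n)))
  cube-root-of-unity′ (N@(suc N′) , eq) = from-nonroot (Poly-nonroot f-Poly small)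
    where
    q≡1+3N : 2 ^ suc n ≡ 1 ℕ.+ 3 ℕ.* N
    q≡1+3N = ≡.trans (≡.cong (2 ^_) even) eq
    small : suc N ℕ.< 2 ^ suc n
    small = ≡.subst (suc N ℕ.<_) (≡.sym q≡1+3N) (ℕ.s≤s (ℕ.m<m+n N {2 ℕ.* N} (ℕ.s≤s ℕ.z≤n)))
    f : Carrier → Carrier
    f x = pow F x (suc N) + x
    f-Poly : Poly 1# (suc N) f
    f-Poly = Poly-lead (+-identityʳ 1#) (Poly-+ (Poly-pow (suc N))
      (≡.subst (λ d → Poly 0# d (λ x → x)) (ℕ.+-comm N 1) (Poly-raise-+ N′ (Poly-resp *-identityʳ (Poly-pow 1)))))
    from-nonroot : (∃ λ x → ¬ f x ≈ 0#) → ∃ λ ω → ω * ω + ω + 1# ≈ 0#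
    from-nonroot (x , fx≉0) = pow F x N , primitive-cube-root (cube-pow≈1 N q≡1+3N x≉0)
        (λ e → fx≉0 (x≈y⇒x+y≈0 {x * pow F x N} {x} (trans (*-congˡ e) (*-identityʳ x))))
      where
      x≉0 : ¬ x ≈ 0#
      x≉0 x≈0 = fx≉0 (trans (+-cong (trans (*-congʳ x≈0) (zeroˡ (pow F x N))) x≈0) (+-identityʳ 0#))

  abstract
    cube-root-of-unity : ∃ λ ω → ω * ω + ω + 1# ≈ 0#
    cube-root-of-unity = cube-root-of-unity′ (2^2h≡1+3N h)

  ω : Carrier
  ω = proj₁ cube-root-of-unity

  ω²+ω+1≈0 : ω * ω + ω + 1# ≈ 0#
  ω²+ω+1≈0 = proj₂ cube-root-of-unity

  -- Here `ω + 1#` is ω². The product differs from x³ + r³ by a multiple of ω² + ω + 1.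
  cube-factor : ∀ x r → (x + r) * ((x + ω * r) * (x + (ω + 1#) * r)) ≈ cube x + cube r
  cube-factor x r = trans
    (solve 3 (λ x r w → (x :+ r) :* ((x :+ w :* r) :* (x :+ (w :+ con true) :* r)) :=
       x :^ 3 :+ r :^ 3 :+ (w :* w :+ w :+ con true) :* (x :* r :* r :+ r :^ 3)) refl x r ω)
    (trans (+-congˡ (trans (*-congʳ ω²+ω+1≈0) (zeroˡ _))) (+-identityʳ _))

  cube-fibre : ∀ x r → cube x ≈ cube r → x ≈ r ⊎ x ≈ ω * r ⊎ x ≈ (ω + 1#) * r
  cube-fibre x r eq with *-zero-split (trans (cube-factor x r) (x≈y⇒x+y≈0 eq))
  ... | inj₁ e = inj₁ (x+y≈0⇒x≈y e)
  ... | inj₂ e with *-zero-split e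
  ...   | inj₁ d = inj₂ (inj₁ (x+y≈0⇒x≈y d))
  ...   | inj₂ d = inj₂ (inj₂ (x+y≈0⇒x≈y d))

  cube-equal : ∀ x r → (x + r) * ((x + ω * r) * (x + (ω + 1#) * r)) ≈ 0# → cube x ≈ cube r
  cube-equal x r e = x+y≈0⇒x≈y (trans (sym (cube-factor x r)) e)

  ω≉0 : ¬ ω ≈ 0#
  ω≉0 e = 1≉0 (trans (sym (trans (+-congʳ (trans (+-cong (trans (*-congʳ e) (zeroˡ ω)) e) (+-identityʳ 0#))) (+-identityˡ 1#))) ω²+ω+1≈0)

  ω≉1 : ¬ ω ≈ 1#
  ω≉1 e = 1≉0 (trans (sym (trans (+-congʳ (trans (+-cong (trans (*-cong e e) (*-identityʳ 1#)) e) 1+1≈0)) (+-identityˡ 1#))) ω²+ω+1≈0)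

  -- The brackets simply add because r, ωr and ω²r are distinct: a coincidence would force ω = 1, ω
  -- = 0 or r = 0.
  cube-fibre-indicator : ∀ {r} → ¬ r ≈ 0# → ∀ x →
    [ cube x ≟ cube r ] ≡ [ x ≟ r ] +ℤ ([ x ≟ (ω * r) ] +ℤ [ x ≟ ((ω + 1#) * r) ])
  cube-fibre-indicator {r} r≉0 x with x ≟ r | x ≟ (ω * r) | x ≟ ((ω + 1#) * r)
  ... | yes e | yes d | _     = contradiction (*-cancelʳ (trans (sym d) (trans e (sym (*-identityˡ r))))) ω≉1
    where
    *-cancelʳ : ∀ {a b} → a * r ≈ b * r → a ≈ b
    *-cancelʳ {a} {b} eq = *-cancelˡ r≉0 (trans (*-comm r a) (trans eq (*-comm b r)))
  ... | yes e | no _  | yes d = contradiction (*-cancelˡ r≉0 (x+y≈0⇒x≈y (trans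
      (solve 2 (λ r w → r :* w :+ r :* con (false) := (w :+ con true) :* r :+ r) refl r ω)
      (x≈y⇒x+y≈0 (trans (sym d) e))))) ω≉0
  ... | yes e | no _  | no _  = []-yes (cube x ≟ cube r) (cube-cong e)
  ... | no _  | yes e | yes d = contradiction (trans
      (solve 2 (λ r w → r := w :* r :+ (w :+ con true) :* r) refl r ω)
      (x≈y⇒x+y≈0 (trans (sym e) d))) r≉0
  ... | no _  | yes e | no _  = []-yes (cube x ≟ cube r)
      (cube-equal x r (trans (*-congˡ (trans (*-congʳ (x≈y⇒x+y≈0 e)) (zeroˡ _))) (zeroʳ _)))
  ... | no _  | no _  | yes e = []-yes (cube x ≟ cube r)
      (cube-equal x r (trans (*-congˡ (trans (*-congˡ (x≈y⇒x+y≈0 e)) (zeroʳ _))) (zeroʳ _)))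
  ... | no a  | no b  | no d  = []-no (cube x ≟ cube r) (λ eq → [ a , [ b , d ]′ ]′ (cube-fibre x r eq))

  cube-fibre-size : ∀ {r} → ¬ r ≈ 0# → ∑ (λ x → [ cube x ≟ cube r ]) ≡ + 3
  cube-fibre-size {r} r≉0 = begin
    ∑ (λ x → [ cube x ≟ cube r ])                                          ≡⟨ ∑-cong (cube-fibre-indicator r≉0) ⟩
    ∑ (λ x → A x +ℤ (B x +ℤ C x))                                          ≡⟨ ∑-+ A (λ x → B x +ℤ C x) ⟩
    ∑ A +ℤ ∑ (λ x → B x +ℤ C x)                                            ≡⟨ ≡.cong (∑ A +ℤ_) (∑-+ B C) ⟩
    ∑ A +ℤ (∑ B +ℤ ∑ C)                                                    ≡⟨ ≡.cong₂ _+ℤ_ (∑-δ₁ r) (≡.cong₂ _+ℤ_ (∑-δ₁ _) (∑-δ₁ _)) ⟩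
    + 3                                                                    ∎
    where
    A B C : Carrier → ℤ
    A x = [ x ≟ r ]
    B x = [ x ≟ (ω * r) ]
    C x = [ x ≟ ((ω + 1#) * r) ]

  x⁴≈x : ∀ x → x * x * x * x ≈ x → x ≈ 0# ⊎ cube x ≈ 1#
  x⁴≈x x eq with x ≟ 0#
  ... | yes x≈0 = inj₁ x≈0
  ... | no  x≉0 = inj₂ (*-cancelˡ x≉0 (trans
        (solve 1 (λ x → x :* x :^ 3 := x :* x :* x :* x) refl x) (trans eq (sym (*-identityʳ x)))))

  x³≈1⇒x⁴≈x : ∀ {x} → cube x ≈ 1# → x * x * x * x ≈ x
  x³≈1⇒x⁴≈x {x} e = trans (solve 1 (λ x → x :* x :* x :* x := x :* x :^ 3) refl x) (trans (*-congˡ e) (*-identityʳ x))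

  ∑-cube≟1 : ∑ (λ x → [ cube x ≟ 1# ]) ≡ + 3
  ∑-cube≟1 = ≡.trans (∑-cong (λ x → ≟-cong (refl {cube x}) (sym (pow-1 3)))) (cube-fibre-size 1≉0)

  -- These are the elements of GF(4): zero and the three cube roots of unity.
  ∑-x⁴≟x : ∑ (λ x → [ (x * x * x * x) ≟ x ]) ≡ + 4
  ∑-x⁴≟x = ≡.trans (∑-cong split) (≡.trans (∑-+ (λ x → [ x ≟ 0# ]) (λ x → [ cube x ≟ 1# ]))
    (≡.cong₂ _+ℤ_ (∑-δ₁ 0#) ∑-cube≟1))
    where
    split : ∀ x → [ (x * x * x * x) ≟ x ] ≡ [ x ≟ 0# ] +ℤ [ cube x ≟ 1# ]
    split x with x ≟ 0# | cube x ≟ 1#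
    ... | yes e | yes d = contradiction (trans (sym d) (trans (cube-cong e) cube-0)) 1≉0
    ... | yes e | no _  = []-yes (_ ≟ x) (trans (*-congˡ e) (trans (zeroʳ _) (sym e)))
    ... | no _  | yes d = []-yes (_ ≟ x) (x³≈1⇒x⁴≈x d)
    ... | no a  | no b  = []-no (_ ≟ x) (λ eq → [ a , b ]′ (x⁴≈x x eq))

  x⁴≈x⇒T-cube≈0 : ∀ x → x * x * x * x ≈ x → T (cube x) ≈ 0#
  x⁴≈x⇒T-cube≈0 x eq with x⁴≈x x eq
  ... | inj₁ e = trans (T-cong (trans (cube-cong e) cube-0)) T-0
  ... | inj₂ e = trans (T-cong e) T-1

  S : ℤ
  S = ∑ (χ ∘ cube)

  -- Translating one factor by the variable y of the other turns the summand into χ(x³ + x²y + xy²).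
  -- The sum over y keeps only the four x with x⁴ = x, and there χ(x³) = 1, so each contributes
  -- exactly q.
  S-square : S *ℤ S ≡ + 4 *ℤ + q
  S-square = begin
    S *ℤ S                                                        ≡⟨ ≡.sym (∑-*ˡ S (χ ∘ cube)) ⟩
    ∑ (λ y → S *ℤ χ (cube y))                                     ≡⟨ ∑-cong (λ y → ≡.cong (_*ℤ χ (cube y)) (∑-translate (λ e → χ-cong (cube-cong e)) y)) ⟩
    ∑ (λ y → ∑ (λ x → χ (cube (x + y))) *ℤ χ (cube y))            ≡⟨ ∑-cong (λ y → ≡.sym (∑-*ʳ (χ (cube y)) (λ x → χ (cube (x + y))))) ⟩
    ∑ (λ y → ∑ (λ x → χ (cube (x + y)) *ℤ χ (cube y)))            ≡⟨ ∑-cong (λ y → ∑-cong (λ x → polarise x y)) ⟩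
    ∑ (λ y → ∑ (λ x → χ (cube x) *ℤ χ (B x y)))                   ≡⟨ ∑-swap (λ y x → χ (cube x) *ℤ χ (B x y)) ⟩
    ∑ (λ x → ∑ (λ y → χ (cube x) *ℤ χ (B x y)))                   ≡⟨ ∑-cong (λ x → ∑-*ˡ (χ (cube x)) (χ ∘ B x)) ⟩
    ∑ (λ x → χ (cube x) *ℤ ∑ (χ ∘ B x))                           ≡⟨ ∑-cong (λ x → ≡.trans (≡.cong (χ (cube x) *ℤ_) (∑χ-polar x)) (trivial x)) ⟩
    ∑ (λ x → + q *ℤ [ (x * x * x * x) ≟ x ])                      ≡⟨ ∑-*ˡ (+ q) (λ x → [ (x * x * x * x) ≟ x ]) ⟩
    + q *ℤ ∑ (λ x → [ (x * x * x * x) ≟ x ])                      ≡⟨ ≡.cong (+ q *ℤ_) ∑-x⁴≟x ⟩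
    + q *ℤ + 4                                                    ≡⟨ ℤ.*-comm (+ q) (+ 4) ⟩
    + 4 *ℤ + q                                                    ∎
    where
    B : Carrier → Carrier → Carrier
    B x y = x * x * y + x * y * y
    polarise : ∀ x y → χ (cube (x + y)) *ℤ χ (cube y) ≡ χ (cube x) *ℤ χ (B x y)
    polarise x y = ≡.trans (≡.sym (χ-+ _ _)) (≡.trans (χ-cong
      (solve 2 (λ x y → (x :+ y) :^ 3 :+ y :^ 3 := x :^ 3 :+ (x :* x :* y :+ x :* y :* y)) refl x y)) (χ-+ _ _))
    trivial : ∀ x → χ (cube x) *ℤ (+ q *ℤ [ (x * x * x * x) ≟ x ]) ≡ + q *ℤ [ (x * x * x * x) ≟ x ]
    trivial x with (x * x * x * x) ≟ x
    ... | no  _  = ≡.trans (≡.cong (χ (cube x) *ℤ_) (ℤ.*-zeroʳ (+ q))) (≡.trans (ℤ.*-zeroʳ (χ (cube x))) (≡.sym (ℤ.*-zeroʳ (+ q))))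
    ... | yes eq = ≡.trans (≡.cong (_*ℤ (+ q *ℤ 1ℤ)) (χ-0 (x⁴≈x⇒T-cube≈0 x eq))) (ℤ.*-identityˡ _)

  cube-fibre-mod-3 : ∀ y → ∃ λ e → ∑ (λ x → [ y ≟ cube x ]) ≡ [ y ≟ 0# ] +ℤ + 3 *ℤ e
  cube-fibre-mod-3 y with y ≟ 0#
  ... | yes y≈0 = 0ℤ , ≡.trans (∑-cong (λ x → []-cong (y ≟ cube x) (x ≟ 0#)
          (λ e → cube≈0 (trans (sym e) y≈0)) (λ e → trans y≈0 (sym (trans (cube-cong e) cube-0))))) (∑-δ₁ 0#)
  ... | no y≉0 with Fin.any? (λ i → y ≟ cube (enum i))
  ...   | yes (i , y≈r³) = 1ℤ , ≡.trans (∑-cong (λ x → []-cong (y ≟ cube x) (cube x ≟ cube (enum i))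
            (λ e → trans (sym e) y≈r³) (λ e → trans y≈r³ (sym e))))
          (cube-fibre-size (λ e → y≉0 (trans y≈r³ (trans (cube-cong e) cube-0))))
  ...   | no none = 0ℤ , ≡.trans (sum-cong-≗ (λ i → []-no (y ≟ cube (enum i)) (λ e → none (i , e))))
            (sum-replicate-zero q)

  -- Grouping by the value of the cube, nonzero values come with fibres of size 0 or 3; modulo 3
  -- only the value 0 remains, contributing χ(0) = 1.
  S≡1[3] : ∃ λ t → S ≡ 1ℤ +ℤ + 3 *ℤ t
  S≡1[3] = ∑ (λ y → e y *ℤ χ y) , (begin
    ∑ (λ x → χ (cube x))                                     ≡⟨ ∑-cong (λ x → ≡.sym (∑-δ (cube x) χ-cong)) ⟩
    ∑ (λ x → ∑ (λ y → [ y ≟ cube x ] *ℤ χ y))                ≡⟨ ∑-swap (λ x y → [ y ≟ cube x ] *ℤ χ y) ⟩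
    ∑ (λ y → ∑ (λ x → [ y ≟ cube x ] *ℤ χ y))                ≡⟨ ∑-cong (λ y → ∑-*ʳ (χ y) (λ x → [ y ≟ cube x ])) ⟩
    ∑ (λ y → ∑ (λ x → [ y ≟ cube x ]) *ℤ χ y)                ≡⟨ ∑-cong (λ y → ≡.trans (≡.cong (_*ℤ χ y) (proj₂ (cube-fibre-mod-3 y)))
                                                                 (arith [ y ≟ 0# ] (e y) (χ y))) ⟩
    ∑ (λ y → [ y ≟ 0# ] *ℤ χ y +ℤ + 3 *ℤ (e y *ℤ χ y))       ≡⟨ ∑-+ (λ y → [ y ≟ 0# ] *ℤ χ y) (λ y → + 3 *ℤ (e y *ℤ χ y)) ⟩
    ∑ (λ y → [ y ≟ 0# ] *ℤ χ y) +ℤ ∑ (λ y → + 3 *ℤ (e y *ℤ χ y)) ≡⟨ ≡.cong₂ _+ℤ_ (≡.trans (∑-δ 0# χ-cong) (χ-0 T-0)) (∑-*ˡ (+ 3) (λ y → e y *ℤ χ y)) ⟩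
    1ℤ +ℤ + 3 *ℤ ∑ (λ y → e y *ℤ χ y)                        ∎)
    where
    e : Carrier → ℤ
    e y = proj₁ (cube-fibre-mod-3 y)
    arith : ∀ d e x → (d +ℤ + 3 *ℤ e) *ℤ x ≡ d *ℤ x +ℤ + 3 *ℤ (e *ℤ x)
    arith = solve-∀

  S-value : S ≡ -[1+ 1 ] ^ℤ suc h
  S-value = square-root-unique-mod-3 (proj₁ S≡1[3]) (proj₁ P≡1[3]) (proj₂ S≡1[3]) (proj₂ P≡1[3]) (begin
    S *ℤ S                             ≡⟨ S-square ⟩
    + 4 *ℤ + q                         ≡⟨ ≡.sym (ℤ.pos-* 4 q) ⟩
    + (4 ℕ.* q)                        ≡⟨ ≡.cong +_ (≡.trans (ℕ.*-assoc 2 2 q) (≡.cong (λ d → 2 ^ (2 ℕ.+ d)) even)) ⟩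
    + (2 ^ (2 ℕ.+ 2 ℕ.* h))            ≡⟨ ≡.cong (λ d → + (2 ^ d)) (≡.sym (ℕ.*-suc 2 h)) ⟩
    + (2 ^ (2 ℕ.* suc h))              ≡⟨ ≡.sym ([-2]^h-square (suc h)) ⟩
    (-[1+ 1 ] ^ℤ suc h) *ℤ (-[1+ 1 ] ^ℤ suc h) ∎)
    where
    P≡1[3] = [-2]^h≡1[3] (suc h)

  β : Carrier → ℤ
  β x = [ T (cube x) ≟ 1# ]

  β-cong : Congruent β
  β-cong e = ≟-cong (T-cong (cube-cong e)) refl

  k : ℤ
  k = + (2 ^ n) +ℤ -[1+ 1 ] ^ℤ h

  -- From χ = 1 - 2β on cubes, 2∑β = q - S. Since q = 2 · 2^n and S = -2 · (-2)^h, a factor 2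
  -- cancels.
  ∑β : ∑ β ≡ k
  ∑β = ℤ.*-cancelˡ-≡ (+ 2) (∑ β) k (begin
    + 2 *ℤ ∑ β                                            ≡⟨ arith₁ (+ q) (∑ β) ⟩
    + q +ℤ -ℤ (+ q *ℤ 1ℤ +ℤ -[1+ 1 ] *ℤ ∑ β)              ≡⟨ ≡.cong (λ s → + q +ℤ -ℤ s) (≡.sym S≡) ⟩
    + q +ℤ -ℤ S                                           ≡⟨ ≡.cong₂ (λ a b → a +ℤ -ℤ b) (ℤ.pos-* 2 (2 ^ n)) S-value ⟩
    + 2 *ℤ + (2 ^ n) +ℤ -ℤ (-[1+ 1 ] ^ℤ suc h)            ≡⟨ arith₂ (+ (2 ^ n)) (-[1+ 1 ] ^ℤ h) ⟩
    + 2 *ℤ k                                              ∎)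
    where
    χ≡1-2β : ∀ x → χ (cube x) ≡ 1ℤ +ℤ -[1+ 1 ] *ℤ β x
    χ≡1-2β x with T (cube x) ≟ 1#
    ... | yes _ = ≡.refl
    ... | no  _ = ≡.refl
    S≡ : S ≡ + q *ℤ 1ℤ +ℤ -[1+ 1 ] *ℤ ∑ β
    S≡ = ≡.trans (∑-cong χ≡1-2β) (≡.trans (∑-+ (λ _ → 1ℤ) (λ x → -[1+ 1 ] *ℤ β x))
      (≡.cong₂ _+ℤ_ (∑-const 1ℤ) (∑-*ˡ -[1+ 1 ] β)))
    arith₁ : ∀ q b → + 2 *ℤ b ≡ q +ℤ -ℤ (q *ℤ 1ℤ +ℤ -[1+ 1 ] *ℤ b)
    arith₁ = solve-∀
    arith₂ : ∀ a p → + 2 *ℤ a +ℤ -ℤ (-[1+ 1 ] *ℤ p) ≡ + 2 *ℤ (a +ℤ p)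
    arith₂ = solve-∀

does⇒ : (d : Dec P) → does d ≡ true → P
does⇒ (yes p) _ = p

[]-¬ : (d : Dec P) → [ ¬? d ] ≡ 1ℤ - [ d ]
[]-¬ (yes _) = ≡.refl
[]-¬ (no  _) = ≡.refl

[]-idem : (d : Dec P) → [ d ] *ℤ [ d ] ≡ [ d ]
[]-idem (yes _) = ≡.refl
[]-idem (no  _) = ≡.refl

-- A summand weighted by a bracket may be rewritten under the assumption in the bracket, such as a
-- nonzero slope.
[]-*-cong : (d : Dec P) {u v : ℤ} → (P → u ≡ v) → [ d ] *ℤ u ≡ [ d ] *ℤ v
[]-*-cong (yes x) eq = ≡.cong (1ℤ *ℤ_) (eq x)
[]-*-cong (no _)  eq = ≡.refl

∣S∣≡∑ : ∀ {n} (S : Subset n) → + ∣ S ∣ ≡ sumℤ (λ i → [ i ∈? S ])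
∣S∣≡∑ []            = ≡.refl
∣S∣≡∑ (true ∷ S)  = ≡.cong (1ℤ +ℤ_) (∣S∣≡∑ S)
∣S∣≡∑ (false ∷ S) = ≡.trans (∣S∣≡∑ S) (≡.sym (ℤ.+-identityˡ _))

-- Affine maps that preserve Tr(x³)

module Stabiliser (n h : ℕ) (even : suc n ≡ 2 ℕ.* h) (q≢4 : 2 ^ suc n ≢ 4)
                  {c ℓ : Level} (F : FiniteField (2 ^ suc n) c ℓ) where
  open FiniteField F hiding (_-_; _≉_; zero)
  open FiniteFields F
  open BinaryFields n F
  open EvenDegree n h even F
  open Char2Solver using (solve; _:=_; _:+_; _:*_; _:^_; con)

  T-zero-form : ∀ {z} → (∀ y → T (y * y * z) ≈ 0#) → z ≈ 0#
  T-zero-form {z} all with z ≟ 0#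
  ... | yes z≈0 = z≈0
  ... | no  z≉0 = contradiction (trans (sym (proj₂ (T-nondegenerate z≉0))) (all (proj₁ (T-nondegenerate z≉0)))) 1≉0

  -- These are the mixed terms of (cx + d)³. Squaring the second inside the trace brings both to x²,
  -- which exposes d + d⁴.
  T-linear-part : ∀ c d x → T (c * c * d * x * x + c * d * d * x) ≈ T (x * x * (c * c * (d + d * d * d * d)))
  T-linear-part c d x = trans (T-+ _ _) (trans (+-congˡ (sym (T-square _))) (trans (sym (T-+ _ _))
    (T-cong (solve 3 (λ c d x → c :* c :* d :* x :* x :+ c :* d :* d :* x :* (c :* d :* d :* x) :=
      x :* x :* (c :* c :* (d :+ d :* d :* d :* d))) refl c d x))))

  T-≈⇒+ : ∀ {x y} → T x ≈ T y → T (x + y) ≈ 0#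
  T-≈⇒+ e = trans (T-+ _ _) (x≈y⇒x+y≈0 e)

  T-+0 : ∀ {x y} → T x ≈ 0# → T y ≈ 0# → T (x + y) ≈ 0#
  T-+0 e d = trans (T-+ _ _) (trans (+-cong e d) (+-identityʳ 0#))

  module _ {c d : Carrier} (stable : ∀ x → T (cube (c * x + d)) ≈ T (cube x)) where
    private
      e = cube c + 1#

      G : Carrier → Carrier
      G x = cube (c * x + d) + cube x

      T-G : ∀ x → T (G x) ≈ 0#
      T-G x = T-≈⇒+ (stable x)

      -- The second difference G(x + y) + G(x) + G(y) + G(0) cancels the constant and the additive
      -- terms of G and leaves the polarised cubic term, whose coefficient is e.
      polar : ∀ x y → T (e * (x * x * y + x * y * y)) ≈ 0#
      polar x y = trans (T-cong (solve 4 (λ c d x y →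
          (c :^ 3 :+ con true) :* (x :* x :* y :+ x :* y :* y) :=
          (((c :* (x :+ y) :+ d) :^ 3 :+ (x :+ y) :^ 3) :+ ((c :* x :+ d) :^ 3 :+ x :^ 3)) :+
          (((c :* y :+ d) :^ 3 :+ y :^ 3) :+ ((c :* con false :+ d) :^ 3 :+ (con false) :^ 3))) refl c d x y))
        (T-+0 (T-+0 (T-G (x + y)) (T-G x)) (T-+0 (T-G y) (T-G 0#)))

      quartic : ∀ x → e * e * (x * x * x * x) + e * x ≈ 0#
      quartic x = T-zero-form (λ y → trans (sym (T-polar e x y)) (polar x y))

      -- If e were nonzero, cancelling it would give e x⁴ = x for all x. Taking x = 1 yields e = 1,
      -- so all q elements would satisfy x⁴ = x, although only 4 do; this is where q ≠ 4 enters.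
      e≈0 : e ≈ 0#
      e≈0 with e ≟ 0#
      ... | yes eq = eq
      ... | no e≉0 = contradiction (ℤ.+-injective (≡.trans (≡.sym (≡.trans
              (≡.trans (∑-cong (λ x → []-yes (_ ≟ x) (fixed x))) (∑-const 1ℤ)) (ℤ.*-identityʳ _))) ∑-x⁴≟x)) q≢4
        where
        scaled : ∀ x → e * (x * x * x * x) ≈ x
        scaled x = *-cancelˡ e≉0 (trans (sym (*-assoc e e _)) (x+y≈0⇒x≈y (quartic x)))
        e≈1 : e ≈ 1#
        e≈1 = trans (solve 1 (λ e → e := e :* (con true :* con true :* con true :* con true)) refl e) (scaled 1#)
        fixed : ∀ x → x * x * x * x ≈ x
        fixed x = trans (sym (*-identityˡ _)) (trans (*-congʳ (sym e≈1)) (scaled x))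

    stable⇒c³≈1 : cube c ≈ 1#
    stable⇒c³≈1 = x+y≈0⇒x≈y e≈0

    stable⇒d⁴≈d : d * d * d * d ≈ d
    stable⇒d⁴≈d = [ (λ c²≈0 → contradiction c²≈0 (*-nonzero c≉0 c≉0)) , (λ s → sym (x+y≈0⇒x≈y s)) ]′
      (*-zero-split (T-zero-form (λ x → trans (sym (T-linear-part c d x)) (linear x))))
      where
      c≉0 : ¬ c ≈ 0#
      c≉0 c≈0 = 1≉0 (trans (sym stable⇒c³≈1) (trans (cube-cong c≈0) cube-0))
      -- Adding G(0) removes the constant d³ from G(x), and the cubic term is gone because its
      -- coefficient e is 0.
      linear : ∀ x → T (c * c * d * x * x + c * d * d * x) ≈ 0#
      linear x = trans (T-cong (trans
          (trans (sym (+-identityʳ _)) (+-congˡ (sym (trans (*-congʳ e≈0) (zeroˡ (x * x * x))))))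
          (solve 3 (λ c d x → (c :* c :* d :* x :* x :+ c :* d :* d :* x) :+ (c :^ 3 :+ con true) :* (x :* x :* x) :=
            ((c :* x :+ d) :^ 3 :+ x :^ 3) :+ ((c :* con false :+ d) :^ 3 :+ (con false) :^ 3)) refl c d x)))
        (T-+0 (T-G x) (T-G 0#))

  -- The leading term becomes x³, the mixed terms have trace 0 because d + d⁴ = 0, and Tr(d³) = 0
  -- because d lies in GF(4).
  stabilises : ∀ {c d} → cube c ≈ 1# → d * d * d * d ≈ d → ∀ x → T (cube (c * x + d)) ≈ T (cube x)
  stabilises {c} {d} c³≈1 d⁴≈d x = trans
    (T-cong (trans (solve 3 (λ c d x → (c :* x :+ d) :^ 3 :=
        c :^ 3 :* x :^ 3 :+ ((c :* c :* d :* x :* x :+ c :* d :* d :* x) :+ d :^ 3)) refl c d x)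
      (+-congʳ (trans (*-congʳ c³≈1) (*-identityˡ _)))))
    (trans (T-+ _ _) (trans (+-congˡ (T-+0 linear (x⁴≈x⇒T-cube≈0 d d⁴≈d))) (+-identityʳ _)))
    where
    linear : T (c * c * d * x * x + c * d * d * x) ≈ 0#
    linear = trans (T-linear-part c d x) (trans (T-cong (trans (*-congˡ (trans
      (*-congˡ (x≈y⇒x+y≈0 (sym d⁴≈d))) (zeroʳ _))) (zeroʳ _))) T-0)

-- The list of affine maps as a double sum

module AffineGroup {q : ℕ} {c ℓ : Level} (F : FiniteField q c ℓ) where
  open FiniteField F hiding (_-_; _≉_; zero)
  open FiniteFields F

  -- Names the anonymous local function of GA1, so that it can be analysed by cases.
  GA1-shape : Σ (Fin q → Fin q → List (Carrier × Carrier)) λ f →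
              GA1 F ≡ concatMap (λ i → concatMap (f i) (points F)) (points F)
  GA1-shape = _ , ≡.refl

  sumList-GA1 : ∀ (φ : Carrier × Carrier → ℤ) →
                sumList φ (GA1 F) ≡ ∑ (λ a → [ ¬? (a ≟ 0#) ] *ℤ ∑ (λ b → φ (a , b)))
  sumList-GA1 φ = ≡.trans (sumList-concatMap φ (λ i → concatMap (proj₁ GA1-shape i) (points F)) (points F))
    (≡.trans (sumList-tabulate (λ i → sumList φ (concatMap (proj₁ GA1-shape i) (points F))) id) (sum-cong-≗ λ i →
      ≡.trans (sumList-concatMap φ (proj₁ GA1-shape i) (points F))
        (≡.trans (sumList-tabulate (λ j → sumList φ (proj₁ GA1-shape i j)) id)
          (≡.trans (sum-cong-≗ (single i)) (∑-*ˡ [ ¬? (enum i ≟ 0#) ] (λ b → φ (enum i , b)))))))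
    where
    single : ∀ i j → sumList φ (proj₁ GA1-shape i j) ≡ [ ¬? (enum i ≟ 0#) ] *ℤ φ (enum i , enum j)
    single i j with enum i ≟ 0#
    ... | yes _ = ≡.refl
    ... | no  _ = ≡.trans (ℤ.+-identityʳ _) (≡.sym (ℤ.*-identityˡ _))

  GA1-nonzero : All (λ ab → ¬ proj₁ ab ≈ 0#) (GA1 F)
  GA1-nonzero = All.concat⁺ (All.map⁺ (All.tabulate⁺ (λ i → All.concat⁺ (All.map⁺ (All.tabulate⁺ (single i))))))
    where
    single : ∀ i j → All (λ ab → ¬ proj₁ ab ≈ 0#) (proj₁ GA1-shape i j)
    single i j with enum i ≟ 0#
    ... | yes _   = []
    ... | no  a≉0 = a≉0 ∷ []

-- Block sizes, repetitions of blocks, and the pair count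

module Blocks (n h : ℕ) (even : suc n ≡ 2 ℕ.* h) (q≢4 : 2 ^ suc n ≢ 4)
              {c ℓ : Level} (F : FiniteField (2 ^ suc n) c ℓ) where
  open FiniteField F hiding (_-_; _≉_; zero)
  open FiniteFields F
  open AffineGroup F
  open BinaryFields n F
  open Characters n F
  open EvenDegree n h even F
  open Stabiliser n h even q≢4 F
  open Char2Solver using (solve; _:=_; _:+_; _:*_)
  open ≡.≡-Reasoning

  private
    q = 2 ^ suc n

  B : Subset q
  B = baseBlock F (suc n)

  -- Definitionally the equality test with which `blocks` removes repetitions.
  _≟ˢ_ : (S S′ : Subset q) → Dec (S ≡ S′)
  _≟ˢ_ = ≡-dec Bool._≟_

  a⁻¹a : ∀ {a} → ¬ a ≈ 0# → ∀ x → a ⁻¹ * (a * x) ≈ x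
  a⁻¹a {a} a≉0 x = trans (sym (*-assoc (a ⁻¹) a x))
    (trans (*-congʳ (trans (*-comm (a ⁻¹) a) (⁻¹-inverse a≉0))) (*-identityˡ x))

  aa⁻¹ : ∀ {a} → ¬ a ≈ 0# → ∀ x → a * (a ⁻¹ * x) ≈ x
  aa⁻¹ {a} a≉0 x = trans (sym (*-assoc a (a ⁻¹) x)) (trans (*-congʳ (⁻¹-inverse a≉0)) (*-identityˡ x))

  x+b+b≈x : ∀ x b → x + b + b ≈ x
  x+b+b≈x = solve 2 (λ x b → x :+ b :+ b := x) refl

  -- In characteristic 2 the inverse of x ↦ a x + b is x ↦ a⁻¹(x + b). The expression is symmetric
  -- in x and b, so it also serves for sums over translations.
  ∑-affine : ∀ {g} → Congruent g → ∀ {a} → ¬ a ≈ 0# → ∀ b → ∑ g ≡ ∑ (λ x → g (a ⁻¹ * (x + b)))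
  ∑-affine g-cong {a} a≉0 b = ∑-reindex g-cong (λ x → a ⁻¹ * (x + b)) (λ x → a * x + b)
    (λ e → *-congˡ (+-congʳ e)) (λ e → +-congʳ (*-congˡ e))
    (λ x → trans (*-congˡ (x+b+b≈x (a * x) b)) (a⁻¹a a≉0 x))
    (λ x → trans (+-congʳ (aa⁻¹ a≉0 (x + b))) (x+b+b≈x x b))

  ∈-B⁺ : ∀ i → T (cube (enum i)) ≈ 1# → i ∈ B
  ∈-B⁺ i e = lookup⇒[]= i B (≡.trans (lookup∘tabulate _ i) (dec-true (T (cube (enum i)) ≟ 1#) e))

  ∈-B⁻ : ∀ i → i ∈ B → T (cube (enum i)) ≈ 1#
  ∈-B⁻ i i∈ = does⇒ (T (cube (enum i)) ≟ 1#) (≡.trans (≡.sym (lookup∘tabulate _ i)) ([]=⇒lookup i∈))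

  module _ {a : Carrier} (a≉0 : ¬ a ≈ 0#) (b : Carrier) where

    private
      hits? : ∀ j i → Dec (i ∈ B × (a * enum i + b) ≈ enum j)
      hits? j i = (i ∈? B) ×-dec ((a * enum i + b) ≟ enum j)

    ∈-image⁺ : ∀ j → T (cube (a ⁻¹ * (enum j + b))) ≈ 1# → j ∈ image F a b B
    ∈-image⁺ j e = lookup⇒[]= j _ (≡.trans (lookup∘tabulate _ j)
      (dec-true (any? (hits? j) (points F)) (List.lose (∈-allFin i) (∈-B⁺ i (trans (T-cong (cube-cong i≈)) e) ,
        trans (+-congʳ (trans (*-congˡ i≈) (aa⁻¹ a≉0 _))) (x+b+b≈x _ b)))))
      where
      i = index (a ⁻¹ * (enum j + b))
      i≈ = enum-index (a ⁻¹ * (enum j + b))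

    ∈-image⁻ : ∀ j → j ∈ image F a b B → T (cube (a ⁻¹ * (enum j + b))) ≈ 1#
    ∈-image⁻ j j∈ with satisfied (does⇒ (any? (hits? j) (points F))
                         (≡.trans (≡.sym (lookup∘tabulate _ j)) ([]=⇒lookup j∈)))
    ... | i , i∈B , eq = trans (T-cong (cube-cong (trans (*-congˡ (trans (+-congʳ (sym eq)) (x+b+b≈x _ b))) (a⁻¹a a≉0 (enum i)))))
                           (∈-B⁻ i i∈B)

    ∈-image : ∀ j → [ j ∈? image F a b B ] ≡ β (a ⁻¹ * (enum j + b))
    ∈-image j = []-cong (j ∈? image F a b B) (_ ≟ 1#) (∈-image⁻ j) (∈-image⁺ j)

    ∣image∣ : + ∣ image F a b B ∣ ≡ k
    ∣image∣ = ≡.trans (∣S∣≡∑ (image F a b B)) (≡.trans (sum-cong-≗ ∈-image) (≡.trans (≡.sym (∑-affine β-cong a≉0 b)) ∑β))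

  T-ext : ∀ {x y} → (T x ≈ 1# → T y ≈ 1#) → (T y ≈ 1# → T x ≈ 1#) → T x ≈ T y
  T-ext {x} {y} f g with T-binary x | T-binary y
  ... | inj₁ e | inj₁ d = trans e (sym d)
  ... | inj₁ e | inj₂ d = contradiction (trans (sym (g d)) e) 1≉0
  ... | inj₂ e | inj₁ d = contradiction (trans (sym (f e)) d) 1≉0
  ... | inj₂ e | inj₂ d = trans e (sym d)

  module _ {a a′ : Carrier} (a≉0 : ¬ a ≈ 0#) (a′≉0 : ¬ a′ ≈ 0#) (b b′ : Carrier) where

    private
      γ δ : Carrier
      γ = a′ ⁻¹ * a
      δ = a′ ⁻¹ * (b′ + b)

      -- The affine map (a′, b′)⁻¹ ∘ (a, b).
      quotient : ∀ x → a′ ⁻¹ * (a * x + b + b′) ≈ γ * x + δ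
      quotient x = solve 5 (λ u a x b b′ → u :* (a :* x :+ b :+ b′) := u :* a :* x :+ u :* (b′ :+ b)) refl (a′ ⁻¹) a x b b′

    -- The point a x + b has preimages x and γ x + δ under the two maps. Equal images make the
    -- traces of their cubes agree for every x, so the quotient map is in the stabiliser.
    image-≡⁻ : image F a′ b′ B ≡ image F a b B → cube γ ≈ 1# × δ * δ * δ * δ ≈ δ
    image-≡⁻ eq = stable⇒c³≈1 stable , stable⇒d⁴≈d stable
      where
      stable : ∀ x → T (cube (γ * x + δ)) ≈ T (cube x)
      stable x = T-ext
        (λ e → trans (T-cong (cube-cong (sym via))) (∈-image⁻ a≉0 b j
          (≡.subst (j ∈_) eq (∈-image⁺ a′≉0 b′ j (trans (T-cong (cube-cong via′)) e)))))
        (λ e → trans (T-cong (cube-cong (sym via′))) (∈-image⁻ a′≉0 b′ j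
          (≡.subst (j ∈_) (≡.sym eq) (∈-image⁺ a≉0 b j (trans (T-cong (cube-cong via)) e)))))
        where
        j = index (a * x + b)
        via : a ⁻¹ * (enum j + b) ≈ x
        via = trans (*-congˡ (trans (+-congʳ (enum-index _)) (x+b+b≈x _ b))) (a⁻¹a a≉0 x)
        via′ : a′ ⁻¹ * (enum j + b′) ≈ γ * x + δ
        via′ = trans (*-congˡ (+-congʳ (enum-index _))) (quotient x)

    image-≡⁺ : cube γ ≈ 1# → δ * δ * δ * δ ≈ δ → image F a′ b′ B ≡ image F a b B
    image-≡⁺ γ³≈1 δ⁴≈δ = ⊆-antisym
      (λ {j} j∈ → ∈-image⁺ a≉0 b j (trans (sym (same j)) (∈-image⁻ a′≉0 b′ j j∈)))
      (λ {j} j∈ → ∈-image⁺ a′≉0 b′ j (trans (same j) (∈-image⁻ a≉0 b j j∈)))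
      where
      same : ∀ j → T (cube (a′ ⁻¹ * (enum j + b′))) ≈ T (cube (a ⁻¹ * (enum j + b)))
      same j = trans (T-cong (cube-cong (trans
          (*-congˡ (+-congʳ (sym (trans (+-congʳ (aa⁻¹ a≉0 _)) (x+b+b≈x _ b))))) (quotient _))))
        (stabilises γ³≈1 δ⁴≈δ _)

    [image-≡] : [ image F a′ b′ B ≟ˢ image F a b B ] ≡ [ cube γ ≟ 1# ] *ℤ [ (δ * δ * δ * δ) ≟ δ ]
    [image-≡] = ≡.trans ([]-cong (image F a′ b′ B ≟ˢ image F a b B) ((cube γ ≟ 1#) ×-dec ((δ * δ * δ * δ) ≟ δ))
      image-≡⁻ (λ { (e , d) → image-≡⁺ e d })) ([]-× (cube γ ≟ 1#) ((δ * δ * δ * δ) ≟ δ))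

  -- The condition γ³ = 1 says a′³ = a³, which leaves 3 slopes. For each of them δ runs through the
  -- field as b′ does, and δ⁴ = δ picks out 4 translations.
  multiplicity : ∀ {a} → ¬ a ≈ 0# → ∀ b →
    sumList (λ ab → [ image F (proj₁ ab) (proj₂ ab) B ≟ˢ image F a b B ]) (GA1 F) ≡ + 12
  multiplicity {a} a≉0 b = begin
    sumList (λ ab → [ image F (proj₁ ab) (proj₂ ab) B ≟ˢ image F a b B ]) (GA1 F)
      ≡⟨ sumList-GA1 _ ⟩
    ∑ (λ a′ → [ ¬? (a′ ≟ 0#) ] *ℤ ∑ (λ b′ → [ image F a′ b′ B ≟ˢ image F a b B ]))
      ≡⟨ ∑-cong per-slope ⟩
    ∑ (λ a′ → [ cube a′ ≟ cube a ] *ℤ + 4)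
      ≡⟨ ∑-*ʳ (+ 4) (λ a′ → [ cube a′ ≟ cube a ]) ⟩
    ∑ (λ a′ → [ cube a′ ≟ cube a ]) *ℤ + 4
      ≡⟨ ≡.cong (_*ℤ + 4) (cube-fibre-size a≉0) ⟩
    + 12 ∎
    where
    fixed : Carrier → ℤ
    fixed x = [ (x * x * x * x) ≟ x ]
    fixed-cong : Congruent fixed
    fixed-cong e = ≟-cong (*-cong (*-cong (*-cong e e) e) e) e
    γ³≈1⇔ : ∀ {a′} → ¬ a′ ≈ 0# → [ cube (a′ ⁻¹ * a) ≟ 1# ] ≡ [ cube a′ ≟ cube a ]
    γ³≈1⇔ {a′} a′≉0 = []-cong (cube (a′ ⁻¹ * a) ≟ 1#) (cube a′ ≟ cube a)
      (λ e → trans (sym (trans (*-congˡ e) (*-identityʳ (cube a′)))) product)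
      (λ e → *-cancelˡ (pow-nonzero 3 a′≉0) (trans product (trans (sym e) (sym (*-identityʳ (cube a′))))))
      where
      product : cube a′ * cube (a′ ⁻¹ * a) ≈ cube a
      product = trans (sym (cube-* a′ (a′ ⁻¹ * a))) (cube-cong (aa⁻¹ a′≉0 a))
    per-slope : ∀ a′ → [ ¬? (a′ ≟ 0#) ] *ℤ ∑ (λ b′ → [ image F a′ b′ B ≟ˢ image F a b B ]) ≡ [ cube a′ ≟ cube a ] *ℤ + 4
    per-slope a′ with a′ ≟ 0#
    -- The excluded slope 0 contributes nothing on the right either, since a³ is nonzero.
    ... | yes a′≈0 = ≡.cong (_*ℤ + 4) (≡.sym ([]-no (cube a′ ≟ cube a)
            (λ e → a≉0 (cube≈0 (trans (sym e) (trans (cube-cong a′≈0) cube-0))))))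
    ... | no a′≉0 = ≡.trans (ℤ.*-identityˡ _) (begin
      ∑ (λ b′ → [ image F a′ b′ B ≟ˢ image F a b B ])                           ≡⟨ ∑-cong ([image-≡] a≉0 a′≉0 b) ⟩
      ∑ (λ b′ → [ cube (a′ ⁻¹ * a) ≟ 1# ] *ℤ fixed (a′ ⁻¹ * (b′ + b)))          ≡⟨ ∑-*ˡ [ cube (a′ ⁻¹ * a) ≟ 1# ] (λ b′ → fixed (a′ ⁻¹ * (b′ + b))) ⟩
      [ cube (a′ ⁻¹ * a) ≟ 1# ] *ℤ ∑ (λ b′ → fixed (a′ ⁻¹ * (b′ + b)))          ≡⟨ ≡.cong₂ _*ℤ_ (γ³≈1⇔ a′≉0)
                                                                                     (≡.trans (≡.sym (∑-affine fixed-cong a′≉0 b)) ∑-x⁴≟x) ⟩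
      [ cube a′ ≟ cube a ] *ℤ + 4                                               ∎)

  autocorrelation : Carrier → ℤ
  autocorrelation w = ∑ (λ u → β u *ℤ β (u + w))

  autocorrelation-cong : Congruent autocorrelation
  autocorrelation-cong e = ∑-cong (λ u → ≡.cong (β u *ℤ_) (β-cong (+-congˡ {u} e)))

  -- Over all differences w the sum counts the k² ordered pairs of elements of B; w = 0 accounts for
  -- the k diagonal ones.
  ∑-autocorrelation : ∑ (λ w → [ ¬? (w ≟ 0#) ] *ℤ autocorrelation w) ≡ k *ℤ (k - 1ℤ)
  ∑-autocorrelation = begin
    ∑ (λ w → [ ¬? (w ≟ 0#) ] *ℤ A w)                     ≡⟨ ∑-cong (λ w → ≡.trans (≡.cong (_*ℤ A w) ([]-¬ (w ≟ 0#))) (expand [ w ≟ 0# ] (A w))) ⟩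
    ∑ (λ w → A w +ℤ -1ℤ *ℤ ([ w ≟ 0# ] *ℤ A w))          ≡⟨ ∑-+ A (λ w → -1ℤ *ℤ ([ w ≟ 0# ] *ℤ A w)) ⟩
    ∑ A +ℤ ∑ (λ w → -1ℤ *ℤ ([ w ≟ 0# ] *ℤ A w))          ≡⟨ ≡.cong₂ _+ℤ_ total (≡.trans (∑-*ˡ -1ℤ (λ w → [ w ≟ 0# ] *ℤ A w))
                                                               (≡.cong (-1ℤ *ℤ_) (≡.trans (∑-δ 0# autocorrelation-cong) at-0))) ⟩
    k *ℤ k +ℤ -1ℤ *ℤ k                                   ≡⟨ collect k ⟩
    k *ℤ (k - 1ℤ)                                        ∎
    where
    A = autocorrelation
    expand : ∀ d x → (1ℤ - d) *ℤ x ≡ x +ℤ -1ℤ *ℤ (d *ℤ x)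
    expand = solve-∀
    collect : ∀ k → k *ℤ k +ℤ -1ℤ *ℤ k ≡ k *ℤ (k - 1ℤ)
    collect = solve-∀
    at-0 : A 0# ≡ k
    at-0 = ≡.trans (∑-cong (λ u → ≡.trans (≡.cong (β u *ℤ_) (β-cong (+-identityʳ u))) ([]-idem (T (cube u) ≟ 1#)))) ∑β
    total : ∑ A ≡ k *ℤ k
    total = begin
      ∑ (λ w → ∑ (λ u → β u *ℤ β (u + w)))   ≡⟨ ∑-swap (λ w u → β u *ℤ β (u + w)) ⟩
      ∑ (λ u → ∑ (λ w → β u *ℤ β (u + w)))   ≡⟨ ∑-cong (λ u → ≡.trans (∑-*ˡ (β u) (λ w → β (u + w))) (≡.cong (β u *ℤ_)
                                                 (≡.trans (∑-cong (λ w → β-cong (+-comm u w))) (≡.trans (≡.sym (∑-translate β-cong u)) ∑β)))) ⟩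
      ∑ (λ u → β u *ℤ k)                     ≡⟨ ∑-*ʳ k β ⟩
      ∑ β *ℤ k                               ≡⟨ ≡.cong (_*ℤ k) ∑β ⟩
      k *ℤ k                                 ∎

  -- The affine maps carrying two distinct points x, y into B correspond to the pairs (u, w)
  -- with w ≠ 0 and u, u + w ∈ B, where u = a⁻¹(x + b) and w = a⁻¹(x + y).
  flags : ∀ x y → x ≢ y →
    sumList (λ ab → [ (x ∈? image F (proj₁ ab) (proj₂ ab) B) ×-dec (y ∈? image F (proj₁ ab) (proj₂ ab) B) ]) (GA1 F)
      ≡ k *ℤ (k - 1ℤ)
  flags x y x≢y = begin
    sumList (λ ab → [ (x ∈? image F (proj₁ ab) (proj₂ ab) B) ×-dec (y ∈? image F (proj₁ ab) (proj₂ ab) B) ]) (GA1 F)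
      ≡⟨ sumList-GA1 _ ⟩
    ∑ (λ a → [ ¬? (a ≟ 0#) ] *ℤ ∑ (λ b → [ (x ∈? image F a b B) ×-dec (y ∈? image F a b B) ]))
      ≡⟨ ∑-cong per-slope ⟩
    ∑ H
      ≡⟨ ∑-reindex H-cong (λ w → D * w ⁻¹) (λ w → D * w ⁻¹) (λ e → *-congˡ (⁻¹-cong e)) (λ e → *-congˡ (⁻¹-cong e))
           involutive involutive ⟩
    ∑ (λ w → H (D * w ⁻¹))
      ≡⟨ ∑-cong (λ w → ≡.cong₂ _*ℤ_ (slope-nonzero w) (autocorrelation-cong (cancel w))) ⟩
    ∑ (λ w → [ ¬? (w ≟ 0#) ] *ℤ autocorrelation w)
      ≡⟨ ∑-autocorrelation ⟩
    k *ℤ (k - 1ℤ) ∎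
    where
    D : Carrier
    D = enum x + enum y
    D≉0 : ¬ D ≈ 0#
    D≉0 e = x≢y (enum-injective x y (x+y≈0⇒x≈y e))
    H : Carrier → ℤ
    H a = [ ¬? (a ≟ 0#) ] *ℤ autocorrelation (a ⁻¹ * D)
    H-cong : Congruent H
    H-cong {a} {a′} e = ≡.cong₂ _*ℤ_
      ([]-cong (¬? (a ≟ 0#)) (¬? (a′ ≟ 0#)) (λ f d → f (trans e d)) (λ f d → f (trans (sym e) d)))
      (autocorrelation-cong (*-congʳ (⁻¹-cong e)))
    -- Since 0 ⁻¹ = 0, the substitution a = D w⁻¹ is an involution on the whole field.
    cancel : ∀ w → (D * w ⁻¹) ⁻¹ * D ≈ w
    cancel w with w ≟ 0#
    ... | yes w≈0 = trans (*-congʳ (0⁻¹ (zeroʳ D))) (trans (zeroˡ D) (sym w≈0))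
    ... | no  w≉0 = trans (*-congʳ (sym (⁻¹-unique (trans
            (solve 4 (λ D u w v → D :* u :* (w :* v) := D :* v :* (w :* u)) refl D u w (D ⁻¹))
            (trans (*-cong (⁻¹-inverse D≉0) (proj₂ (inverse w w≉0))) (*-identityʳ 1#))))))
          (trans (*-assoc w (D ⁻¹) D) (trans (*-congˡ (trans (*-comm (D ⁻¹) D) (⁻¹-inverse D≉0))) (*-identityʳ w)))
      where
      u = proj₁ (inverse w w≉0)
    involutive : ∀ w → D * (D * w ⁻¹) ⁻¹ ≈ w
    involutive w = trans (*-comm D _) (cancel w)
    slope-nonzero : ∀ w → [ ¬? ((D * w ⁻¹) ≟ 0#) ] ≡ [ ¬? (w ≟ 0#) ]
    slope-nonzero w = []-cong (¬? ((D * w ⁻¹) ≟ 0#)) (¬? (w ≟ 0#))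
      (λ f w≈0 → f (trans (*-congˡ (0⁻¹ w≈0)) (zeroʳ D)))
      (λ w≉0 → *-nonzero D≉0 (⁻¹-nonzero w≉0))
    per-slope : ∀ a → [ ¬? (a ≟ 0#) ] *ℤ ∑ (λ b → [ (x ∈? image F a b B) ×-dec (y ∈? image F a b B) ]) ≡ H a
    per-slope a = []-*-cong (¬? (a ≟ 0#)) (λ a≉0 → begin
      ∑ (λ b → [ (x ∈? image F a b B) ×-dec (y ∈? image F a b B) ])
        ≡⟨ ∑-cong (λ b → ≡.trans ([]-× (x ∈? image F a b B) (y ∈? image F a b B))
             (≡.cong₂ _*ℤ_ (≡.trans (∈-image a≉0 b x) (β-cong (*-congˡ (+-comm (enum x) b))))
               (≡.trans (∈-image a≉0 b y) (β-cong (shift b))))) ⟩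
      ∑ (λ b → β (a ⁻¹ * (b + enum x)) *ℤ β (a ⁻¹ * (b + enum x) + a ⁻¹ * D))
        ≡⟨ ≡.sym (∑-affine {λ u → β u *ℤ β (u + a ⁻¹ * D)} (λ e → ≡.cong₂ _*ℤ_ (β-cong e) (β-cong (+-congʳ e))) a≉0 (enum x)) ⟩
      autocorrelation (a ⁻¹ * D) ∎)
      where
      shift : ∀ b → a ⁻¹ * (enum y + b) ≈ a ⁻¹ * (b + enum x) + a ⁻¹ * D
      shift b = solve 4 (λ u x y b → u :* (y :+ b) := u :* (b :+ x) :+ u :* (x :+ y)) refl (a ⁻¹) (enum x) (enum y) b

  blocks-size : All (λ S → + ∣ S ∣ ≡ k) (blocks F (suc n))
  blocks-size = All.deduplicate⁺ _≟ˢ_ (All.map⁺ (All.map (λ {ab} a≉0 → ∣image∣ a≉0 (proj₂ ab)) GA1-nonzero))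

  -- Both sides count the affine maps whose image of B contains x and y: by distinct image, each
  -- arising from 12 maps, and directly through `flags`.
  blocks-λ : ∀ x y → x ≢ y → + 12 *ℤ + λ-count F (suc n) x y ≡ k *ℤ (k - 1ℤ)
  blocks-λ x y x≢y = ≡.trans
    (≡.cong (+ 12 *ℤ_) (length-filter (λ S → (x ∈? S) ×-dec (y ∈? S)) (blocks F (suc n))))
    (≡.trans (sumList-deduplicate _≟ˢ_ (+ 12) (λ S → [ (x ∈? S) ×-dec (y ∈? S) ]) _
        (All.map⁺ (All.map (λ {ab} a≉0 → ≡.trans (sumList-map _ _ (GA1 F)) (multiplicity a≉0 (proj₂ ab))) GA1-nonzero)))
      (≡.trans (sumList-map _ _ (GA1 F)) (flags x y x≢y)))

theorem17 : ∀ {c ℓ : Level} (m h : ℕ) → m ≡ 2 Data.Nat.* h → 2 ≤ h →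
  (F : FiniteField (2 ^ m) c ℓ) →
  let k : ℤ
      k = + (2 ^ (m ∸ 1)) +ℤ (-[1+ 1 ] ^ℤ h)
  in All (λ S → + ∣ S ∣ ≡ k) (blocks F m)
     × (∀ (x y : Fin (2 ^ m)) → x ≢ y →
          + 12 *ℤ + (λ-count F m x y) ≡ k *ℤ (k - + 1))
theorem17 zero    (suc h) ()
theorem17 (suc n) h even 2≤h F = blocks-size , blocks-λ
  where
  -- From h ≥ 2 the degree is at least 4, which rules out q = 4.
  16≤q : 16 ≤ 2 ^ suc n
  16≤q = ≡.subst (λ d → 16 ≤ 2 ^ d) (≡.sym even) (ℕ.^-monoʳ-≤ 2 (ℕ.*-monoʳ-≤ 2 2≤h))
  q≢4 : 2 ^ suc n ≢ 4
  q≢4 q≡4 with ≡.subst (16 ≤_) q≡4 16≤q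
  ... | ℕ.s≤s (ℕ.s≤s (ℕ.s≤s (ℕ.s≤s ())))
  open Blocks n h even q≢4 F
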